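{- For $n\ge 2$ let $V_n$ be the number of vertices of the polytope $Q_n$. Then, as formal power series, $$x+\sum_{n\geq 2} V_n\,x^n = x+14x^2+150x^3+1536x^4+\cdots=\frac{x+x^2-x^3}{1-13x+31x^2-20x^3+4x^4}.$$
   Context: In $\mathbb{R}^{3\times n}\cong\mathbb{R}^{3n}$ with standard basis $\{e_{i,j}: 0\le i\le 2,\ 0\le j\le n-1\}$, for $0\le i\le 1$ and $0\le j\le n-2$ let $\Delta_{i,j}=\operatorname{conv}\{e_{i,j},e_{i,j+1},e_{i+1,j},e_{i+1,j+1}\}$. The polytope $Q_n$ is the Minkowski sum of these $2(n-1)$ simplices, $Q_n=\sum_{0\le i\le 1,\ 0\le j\le n-2}\Delta_{i,j}$. -}

module Defs where

open import Algebra.Bundles.Raw using (RawMonoid)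
open import Data.Fin as Fin using (Fin; toℕ)
open import Data.Integer as ℤ using (ℤ)
open import Data.List as List using (List)
open import Data.Nat as ℕ using (ℕ; zero; suc; _∸_)
import Data.Nat.Properties as ℕₚ
open import Data.Product using (Σ; ∃; _×_; _,_; proj₁; proj₂)
open import Data.Rational as ℚ using (ℚ; 0ℚ; 1ℚ; ½)
import Data.Rational.Properties as ℚₚ
open import Data.Rational.Solver using (module +-*-Solver)
open import Data.Vec.Functional using (Vector; []; _∷_)
open import Function.Bundles using (Bijection)
open import Level using (0ℓ)
open import Relation.Binary using (Setoid)
open import Relation.Binary.PropositionalEquality using (_≡_; refl; sym; trans; cong; cong₂; subst)
import Relation.Binary.PropositionalEquality.Properties as ≡ₚ
open import Relation.Nullary using (yes; no)
open import Relation.Unary using (Pred; _∈_)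

-- Real numbers are Cauchy sequences of rationals, taken up to _≈_ (difference
-- tending to 0).

Eventually : Pred ℕ 0ℓ → Set
Eventually P = ∃ λ N → ∀ n → N ℕ.≤ n → P n

IsCauchy : (ℕ → ℚ) → Set
IsCauchy x = ∀ ε → 0ℚ ℚ.< ε →
  ∃ λ N → ∀ m n → N ℕ.≤ m → N ℕ.≤ n → ℚ.∣ x m ℚ.- x n ∣ ℚ.< ε

record ℝ : Set where
  constructor mkℝ
  field
    seq    : ℕ → ℚ
    cauchy : IsCauchy seq

open ℝ public

infix 4 _≈_ _≤_

_≈_ : ℝ → ℝ → Set
x ≈ y = ∀ ε → 0ℚ ℚ.< ε → Eventually λ n → ℚ.∣ seq x n ℚ.- seq y n ∣ ℚ.< ε

_≤_ : ℝ → ℝ → Set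
x ≤ y = ∀ ε → 0ℚ ℚ.< ε → Eventually λ n → seq x n ℚ.< seq y n ℚ.+ ε

private
  half>0 : ∀ ε → 0ℚ ℚ.< ε → 0ℚ ℚ.< ½ ℚ.* ε
  half>0 ε ε>0 =
    subst (ℚ._< ½ ℚ.* ε) (ℚₚ.*-zeroʳ ½) (ℚₚ.*-monoʳ-<-pos ½ ε>0)

  half+half : ∀ ε → ½ ℚ.* ε ℚ.+ ½ ℚ.* ε ≡ ε
  half+half ε =
    trans (sym (ℚₚ.*-distribʳ-+ ε ½ ½)) (ℚₚ.*-identityˡ ε)

  ∣p-p∣≡0 : ∀ p → ℚ.∣ p ℚ.- p ∣ ≡ 0ℚ
  ∣p-p∣≡0 p = cong ℚ.∣_∣ (ℚₚ.+-inverseʳ p)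

  ∣p-q∣≡∣q-p∣ : ∀ p q → ℚ.∣ p ℚ.- q ∣ ≡ ℚ.∣ q ℚ.- p ∣
  ∣p-q∣≡∣q-p∣ p q = trans (sym (ℚₚ.∣-p∣≡∣p∣ (p ℚ.- q)))
    (cong ℚ.∣_∣ (solve 2 (λ a b → :- (a :- b) := b :- a) refl p q))
    where open +-*-Solver

  sum-small : ∀ {ε} p q → ℚ.∣ p ∣ ℚ.< ½ ℚ.* ε → ℚ.∣ q ∣ ℚ.< ½ ℚ.* ε →
              ℚ.∣ p ℚ.+ q ∣ ℚ.< ε
  sum-small {ε} p q p< q< = ℚₚ.≤-<-trans (ℚₚ.∣p+q∣≤∣p∣+∣q∣ p q)
    (subst (ℚ.∣ p ∣ ℚ.+ ℚ.∣ q ∣ ℚ.<_) (half+half ε) (ℚₚ.+-mono-< p< q<))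

  const-cauchy : ∀ q → IsCauchy (λ _ → q)
  const-cauchy q ε ε>0 = 0 , λ _ _ _ _ → subst (ℚ._< ε) (sym (∣p-p∣≡0 q)) ε>0

  +-cauchy : ∀ x y → IsCauchy x → IsCauchy y → IsCauchy (λ n → x n ℚ.+ y n)
  +-cauchy x y cx cy ε ε>0 with cx (½ ℚ.* ε) (half>0 ε ε>0) | cy (½ ℚ.* ε) (half>0 ε ε>0)
  ... | M , hx | N , hy = M ℕ.⊔ N , λ m n ≤m ≤n →
    subst (λ t → ℚ.∣ t ∣ ℚ.< ε)
      (solve 4 (λ a b c d → (a :- b) :+ (c :- d) := (a :+ c) :- (b :+ d)) refl
        (x m) (x n) (y m) (y n))
      (sum-small (x m ℚ.- x n) (y m ℚ.- y n)
        (hx m n (ℕₚ.≤-trans (ℕₚ.m≤m⊔n M N) ≤m) (ℕₚ.≤-trans (ℕₚ.m≤m⊔n M N) ≤n))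
        (hy m n (ℕₚ.≤-trans (ℕₚ.m≤n⊔m M N) ≤m) (ℕₚ.≤-trans (ℕₚ.m≤n⊔m M N) ≤n)))
    where open +-*-Solver

  eventually-bounded : ∀ x → IsCauchy x →
    ∃ λ B → 0ℚ ℚ.< B × Eventually (λ n → ℚ.∣ x n ∣ ℚ.< B)
  eventually-bounded x cx with cx 1ℚ (ℚₚ.positive⁻¹ 1ℚ)
  ... | N , h = B , B>0 , N , bound
    where
    open +-*-Solver
    B = 1ℚ ℚ.+ ℚ.∣ x N ∣
    B>0 : 0ℚ ℚ.< B
    B>0 = ℚₚ.+-mono-<-≤ (ℚₚ.positive⁻¹ 1ℚ) (ℚₚ.0≤∣p∣ (x N))
    bound : ∀ n → N ℕ.≤ n → ℚ.∣ x n ∣ ℚ.< B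
    bound n N≤n = ℚₚ.≤-<-trans
      (subst (λ t → ℚ.∣ t ∣ ℚ.≤ ℚ.∣ x n ℚ.- x N ∣ ℚ.+ ℚ.∣ x N ∣)
        (solve 2 (λ a b → (a :- b) :+ b := a) refl (x n) (x N))
        (ℚₚ.∣p+q∣≤∣p∣+∣q∣ (x n ℚ.- x N) (x N)))
      (ℚₚ.+-monoˡ-< ℚ.∣ x N ∣ (h n N N≤n ℕₚ.≤-refl))

  product-small : ∀ B .{{_ : ℚ.Positive B}} δ p q →
    ℚ.∣ p ∣ ℚ.< B → ℚ.∣ q ∣ ℚ.< δ → ℚ.∣ p ℚ.* q ∣ ℚ.< B ℚ.* δ
  product-small B δ p q p< q< = subst (ℚ._< B ℚ.* δ) (sym (ℚₚ.∣p*q∣≡∣p∣*∣q∣ p q))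
    (ℚₚ.≤-<-trans
      (ℚₚ.*-monoʳ-≤-nonNeg ℚ.∣ q ∣ {{ℚₚ.∣-∣-nonNeg q}} (ℚₚ.<⇒≤ p<))
      (ℚₚ.*-monoʳ-<-pos B q<))

  *-cauchy : ∀ x y → IsCauchy x → IsCauchy y → IsCauchy (λ n → x n ℚ.* y n)
  *-cauchy x y cx cy ε ε>0 = K , λ m n ≤m ≤n →
    subst (λ t → ℚ.∣ t ∣ ℚ.< ε)
      (solve 4 (λ a b c d → (a :* (c :- d)) :+ (d :* (a :- b)) := (a :* c) :- (b :* d)) refl
        (x m) (x n) (y m) (y n))
      (sum-small (x m ℚ.* (y m ℚ.- y n)) (y n ℚ.* (x m ℚ.- x n))
        (small (x m) (y m ℚ.- y n)
          (ℚₚ.<-≤-trans (proj₂ Ex m (≥₁ ≤m)) Bx≤B)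
          (proj₂ Cy m n (≥₄ ≤m) (≥₄ ≤n)))
        (small (y n) (x m ℚ.- x n)
          (ℚₚ.<-≤-trans (proj₂ Ey n (≥₂ ≤n)) By≤B)
          (proj₂ Cx m n (≥₃ ≤m) (≥₃ ≤n))))
    where
    open +-*-Solver
    bx = eventually-bounded x cx
    by = eventually-bounded y cy
    Bx = proj₁ bx
    By = proj₁ by
    Ex = proj₂ (proj₂ bx)
    Ey = proj₂ (proj₂ by)
    B = Bx ℚ.+ By
    Bx≤B : Bx ℚ.≤ B
    Bx≤B = subst (ℚ._≤ B) (ℚₚ.+-identityʳ Bx) (ℚₚ.+-monoʳ-≤ Bx (ℚₚ.<⇒≤ (proj₁ (proj₂ by))))
    By≤B : By ℚ.≤ B
    By≤B = subst (ℚ._≤ B) (ℚₚ.+-identityˡ By) (ℚₚ.+-monoˡ-≤ By (ℚₚ.<⇒≤ (proj₁ (proj₂ bx))))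
    instance
      B-pos : ℚ.Positive B
      B-pos = ℚ.positive (ℚₚ.<-≤-trans (proj₁ (proj₂ bx)) Bx≤B)
      B-nonZero : ℚ.NonZero B
      B-nonZero = ℚₚ.pos⇒nonZero B
      B⁻¹-pos : ℚ.Positive (ℚ.1/ B)
      B⁻¹-pos = ℚₚ.1/pos⇒pos B
    δ = ℚ.1/ B ℚ.* (½ ℚ.* ε)
    δ>0 : 0ℚ ℚ.< δ
    δ>0 = subst (ℚ._< δ) (ℚₚ.*-zeroʳ (ℚ.1/ B)) (ℚₚ.*-monoʳ-<-pos (ℚ.1/ B) (half>0 ε ε>0))
    Bδ≡ : B ℚ.* δ ≡ ½ ℚ.* ε
    Bδ≡ = trans (sym (ℚₚ.*-assoc B (ℚ.1/ B) (½ ℚ.* ε)))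
      (trans (cong (ℚ._* (½ ℚ.* ε)) (ℚₚ.*-inverseʳ B)) (ℚₚ.*-identityˡ (½ ℚ.* ε)))
    small : ∀ p q → ℚ.∣ p ∣ ℚ.< B → ℚ.∣ q ∣ ℚ.< δ → ℚ.∣ p ℚ.* q ∣ ℚ.< ½ ℚ.* ε
    small p q p< q< = subst (ℚ.∣ p ℚ.* q ∣ ℚ.<_) Bδ≡ (product-small B δ p q p< q<)
    Cx = cx δ δ>0
    Cy = cy δ δ>0
    N₁ = proj₁ Ex
    N₂ = proj₁ Ey
    N₃ = proj₁ Cx
    N₄ = proj₁ Cy
    K = (N₁ ℕ.⊔ N₂) ℕ.⊔ (N₃ ℕ.⊔ N₄)
    ≥₁ : ∀ {n} → K ℕ.≤ n → N₁ ℕ.≤ n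
    ≥₁ h = ℕₚ.m⊔n≤o⇒m≤o N₁ N₂ (ℕₚ.m⊔n≤o⇒m≤o (N₁ ℕ.⊔ N₂) _ h)
    ≥₂ : ∀ {n} → K ℕ.≤ n → N₂ ℕ.≤ n
    ≥₂ h = ℕₚ.m⊔n≤o⇒n≤o N₁ N₂ (ℕₚ.m⊔n≤o⇒m≤o (N₁ ℕ.⊔ N₂) _ h)
    ≥₃ : ∀ {n} → K ℕ.≤ n → N₃ ℕ.≤ n
    ≥₃ h = ℕₚ.m⊔n≤o⇒m≤o N₃ N₄ (ℕₚ.m⊔n≤o⇒n≤o (N₁ ℕ.⊔ N₂) _ h)
    ≥₄ : ∀ {n} → K ℕ.≤ n → N₄ ℕ.≤ n
    ≥₄ h = ℕₚ.m⊔n≤o⇒n≤o N₃ N₄ (ℕₚ.m⊔n≤o⇒n≤o (N₁ ℕ.⊔ N₂) _ h)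

≈-refl : ∀ {x} → x ≈ x
≈-refl {x} ε ε>0 = 0 , λ n _ → subst (ℚ._< ε) (sym (∣p-p∣≡0 (seq x n))) ε>0

≈-sym : ∀ {x y} → x ≈ y → y ≈ x
≈-sym {x} {y} x≈y ε ε>0 with x≈y ε ε>0
... | N , h = N , λ n N≤n →
  subst (ℚ._< ε) (∣p-q∣≡∣q-p∣ (seq x n) (seq y n)) (h n N≤n)

≈-trans : ∀ {x y z} → x ≈ y → y ≈ z → x ≈ z
≈-trans {x} {y} {z} x≈y y≈z ε ε>0
  with x≈y (½ ℚ.* ε) (half>0 ε ε>0) | y≈z (½ ℚ.* ε) (half>0 ε ε>0)
... | M , h | N , k = M ℕ.⊔ N , λ n ≤n →
  subst (λ t → ℚ.∣ t ∣ ℚ.< ε)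
    (solve 3 (λ a b c → (a :- b) :+ (b :- c) := a :- c) refl (seq x n) (seq y n) (seq z n))
    (sum-small (seq x n ℚ.- seq y n) (seq y n ℚ.- seq z n)
      (h n (ℕₚ.≤-trans (ℕₚ.m≤m⊔n M N) ≤n))
      (k n (ℕₚ.≤-trans (ℕₚ.m≤n⊔m M N) ≤n)))
  where open +-*-Solver

fromℚ : ℚ → ℝ
fromℚ q = mkℝ (λ _ → q) (const-cauchy q)

0ℝ 1ℝ : ℝ
0ℝ = fromℚ 0ℚ
1ℝ = fromℚ 1ℚ

infixl 6 _+_
infixl 7 _*_

_+_ : ℝ → ℝ → ℝ
x + y = mkℝ (λ n → seq x n ℚ.+ seq y n) (+-cauchy (seq x) (seq y) (cauchy x) (cauchy y))

_*_ : ℝ → ℝ → ℝ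
x * y = mkℝ (λ n → seq x n ℚ.* seq y n) (*-cauchy (seq x) (seq y) (cauchy x) (cauchy y))

+-0-rawMonoid : RawMonoid 0ℓ 0ℓ
+-0-rawMonoid = record { Carrier = ℝ ; _≈_ = _≈_ ; _∙_ = _+_ ; ε = 0ℝ }

open import Algebra.Definitions.RawMonoid +-0-rawMonoid public using (sum)

-- ℝ^{3×n}
Point : ℕ → Set
Point n = Fin 3 → Fin n → ℝ

infix 4 _≋_

_≋_ : ∀ {n} → Point n → Point n → Set
x ≋ y = ∀ i j → x i j ≈ y i j

e : ∀ {n} → Fin 3 → Fin n → Point n
e i j i′ j′ with i Fin.≟ i′ | j Fin.≟ j′
... | yes _ | yes _ = 1ℝ
... | _     | _     = 0ℝ

∑ : ∀ {k n} → Vector (Point n) k → Point n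
∑ p i j = sum λ a → p a i j

infixr 7 _·_

_·_ : ∀ {n} → ℝ → Point n → Point n
(t · x) i j = t * x i j

conv : ∀ {k n} → Vector (Point n) k → Pred (Point n) 0ℓ
conv {k} p x = Σ (Vector ℝ k) λ w →
  (∀ a → 0ℝ ≤ w a) × sum w ≈ 1ℝ × x ≋ ∑ (λ a → w a · p a)

minkowskiSum : ∀ {k n} → Vector (Pred (Point n) 0ℓ) k → Pred (Point n) 0ℓ
minkowskiSum {k} {n} S x = Σ (Vector (Point n) k) λ y →
  (∀ a → y a ∈ S a) × x ≋ ∑ y

⟨_,_⟩ : ∀ {n} → Point n → Point n → ℝ
⟨ c , x ⟩ = sum λ i → sum λ j → c i j * x i j

-- {v} is a face of P: the linear functional ⟨ c , _ ⟩ attains its maximum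
-- over P at v and nowhere else.
IsVertex : ∀ {n} → Pred (Point n) 0ℓ → Pred (Point n) 0ℓ
IsVertex {n} P v = v ∈ P × Σ (Point n) λ c →
  ∀ x → x ∈ P → ⟨ c , x ⟩ ≤ ⟨ c , v ⟩ × (⟨ c , x ⟩ ≈ ⟨ c , v ⟩ → x ≋ v)

vertices : ∀ {n} → Pred (Point n) 0ℓ → Setoid 0ℓ 0ℓ
vertices {n} P = record
  { Carrier       = Σ (Point n) (IsVertex P)
  ; _≈_           = λ v w → proj₁ v ≋ proj₁ w
  ; isEquivalence = record
    { refl  = λ {v} i j → ≈-refl {proj₁ v i j}
    ; sym   = λ {v} {w} h i j → ≈-sym {proj₁ v i j} {proj₁ w i j} (h i j)
    ; trans = λ {u} {v} {w} h k i j →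
        ≈-trans {proj₁ u i j} {proj₁ v i j} {proj₁ w i j} (h i j) (k i j)
    }
  }

HasVertexCount : ∀ {n} → Pred (Point n) 0ℓ → ℕ → Set
HasVertexCount P k = Bijection (≡ₚ.setoid (Fin k)) (vertices P)

-- The two embeddings j ↦ j and j ↦ j + 1 of {0, …, n-2} in {0, …, n-1}.
here next : ∀ {n} → Fin (n ∸ 1) → Fin n
here {suc n} = Fin.inject₁
next {suc n} = Fin.suc

Δ : ∀ {n} → Fin 2 → Fin (n ∸ 1) → Pred (Point n) 0ℓ
Δ i j = conv ( e (Fin.inject₁ i) (here j) ∷ e (Fin.inject₁ i) (next j)
             ∷ e (Fin.suc i)     (here j) ∷ e (Fin.suc i)     (next j) ∷ [])

Q : ∀ n → Pred (Point n) 0ℓ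
Q n = minkowskiSum λ (i : Fin 2) → minkowskiSum λ (j : Fin (n ∸ 1)) → Δ i j

PowerSeries : Set
PowerSeries = ℕ → ℤ

infix 4 _≐_

_≐_ : PowerSeries → PowerSeries → Set
f ≐ g = ∀ n → f n ≡ g n

module ℤSum where
  open import Algebra.Definitions.RawMonoid ℤ.+-0-rawMonoid public using (sum)

infixl 7 _⊛_

_⊛_ : PowerSeries → PowerSeries → PowerSeries
(f ⊛ g) n = ℤSum.sum λ (k : Fin (suc n)) → f (toℕ k) ℤ.* g (n ∸ toℕ k)

-- Coefficients are listed from the constant term upwards.
polynomial : List ℤ → PowerSeries
polynomial List.[]       _       = ℤ.0ℤ
polynomial (a List.∷ as) zero    = a
polynomial (a List.∷ as) (suc n) = polynomial as n

-- f = p / q in ℤ[[x]]: q is a unit and f is p times its inverse.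
infix 4 _≐_/_

_≐_/_ : PowerSeries → PowerSeries → PowerSeries → Set
f ≐ p / q = ∃ λ q⁻¹ → q ⊛ q⁻¹ ≐ polynomial (ℤ.1ℤ List.∷ List.[]) × f ≐ p ⊛ q⁻¹

-- x + ∑_{n ≥ 2} V n xⁿ; the values V 0 and V 1 are ignored.
x+∑_ : (ℕ → ℕ) → PowerSeries
(x+∑ V) 0             = ℤ.0ℤ
(x+∑ V) 1             = ℤ.1ℤ
(x+∑ V) (suc (suc n)) = ℤ.+ V (suc (suc n))

{-# OPTIONS --safe #-}

-- A linear functional c attains its maximum over Q_n at a single point exactly
-- when, on each of the simplices, one of the four corners has a strictly larger
-- c-value than the other three. So the vertices are the choices of one corner per
-- simplex that are realizable by heights on the 3 × n grid, that is, for which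
-- "c is larger at the chosen corner" generates no cycle. Reading the grid from
-- left to right, all that matters about the columns already seen is the order they
-- force on the current column. Only eleven orders occur, and the transfer matrix
-- between them gives the recurrence with characteristic polynomial
-- t⁴ − 13t³ + 31t² − 20t + 4.
--
-- Over Cauchy reals order is undecidable, but the argument needs no decision: a
-- vertex comes with convex weights, some weight in each simplex is bounded away
-- from 0, and the corner carrying it is the chosen one.
module Submission where

open import Algebra.Bundles using (CommutativeSemiring)
import Algebra.Properties.CommutativeSemigroup as CommutativeSemigroupProperties
import Algebra.Properties.Semiring.Sum as SemiringSum
open import Data.Bool using (Bool; true; false; _∨_; _∧_; T)
import Data.Bool.Properties as Boolₚ
open import Data.Empty using (⊥; ⊥-elim)
open import Data.Fin as Fin using (Fin; zero; suc; _↑ˡ_; _↑ʳ_; splitAt; punchIn; #_; inject₁)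
import Data.Fin.Properties as Finₚ
open import Data.Integer as ℤ using (ℤ; +_; -_)
import Data.Integer.Properties as ℤₚ
import Data.Integer.Solver as ℤSolver
open import Data.List as List using (List; []; _∷_; _++_; allFin; foldl; tabulate)
open import Data.List.Membership.DecPropositional using (_∈?_)
open import Data.List.Membership.Propositional using () renaming (_∈_ to _∈ₗ_)
open import Data.List.Relation.Unary.All as All using (All; []; _∷_)
import Data.List.Relation.Unary.All.Properties as Allₚ
open import Data.Maybe using (Maybe; just; nothing; maybe)
open import Data.Nat as ℕ using (ℕ; zero; suc; _∸_) renaming (_≤_ to _≤ᴺ_)
import Data.Nat.Coprimality as Coprimality
import Data.Nat.Properties as ℕₚ
open import Data.Product as Product using (Σ; ∃; _×_; _,_; proj₁; proj₂)
import Data.Product.Function.Dependent.Propositional as Σ-Function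
open import Data.Product.Properties using (≡-dec)
open import Data.Rational as ℚ using (ℚ; 0ℚ; 1ℚ; ½)
import Data.Rational.Properties as ℚₚ
import Data.Rational.Solver as ℚSolver
open import Data.Sum using (_⊎_; inj₁; inj₂; [_,_])
open import Data.Sum.Function.Propositional using (_⊎-↔_)
open import Data.Unit using (⊤; tt)
open import Data.Vec as Vec using (Vec; []; _∷_; lookup)
open import Data.Vec.Functional as Vector using (Vector; removeAt)
import Data.Vec.Properties as Vecₚ
open import Function using (_∘_; flip; _↔_; mk↔ₛ′; Bijection; Equivalence; Inverse)
open import Function.Properties.Inverse using (↔-refl; ↔-sym; ↔-trans)
open import Level using (0ℓ)
open import Relation.Binary using (Setoid)
open import Relation.Binary.PropositionalEquality as ≡ using (_≡_; _≢_)
import Relation.Binary.Reasoning.Setoid as SetoidReasoning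
open import Relation.Nullary using (Dec; ¬_; yes; no)
open import Relation.Nullary.Decidable using (isYes; from-yes; toWitness; fromWitness; ¬?; _×-dec_; _→-dec_)
open import Relation.Unary using (Pred; _∈_)

-- Sums in ordered semirings

-- Two notions of strictness have to be reconciled. To build a vertex, each chosen corner must win
-- by a positive gap, as rational heights provide; from a given vertex only `x ≤ y` together with
-- `¬ y ≤ x` can be extracted. The acyclicity argument is therefore stated for an arbitrary
-- transitive irreflexive relation. Applied to the weak notion it turns a vertex into a run of the
-- automaton; the functional of the vertex is then dropped and rational heights are rebuilt from the
-- run alone.
--
-- Rebuilding proceeds from the last column to the first. A state is exactly the order forced from
-- the left, so any heights on a column that respect its state extend to the column before it.
--
-- The recurrence has order four despite the eleven states because counting starts from the all-ones
-- vector: this vector and its first three images under the transfer matrix already span an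
-- invariant subspace.

replace : ∀ {A : Set} {k m} → (Fin k → Fin m → A) → Fin k → Fin m → A → Fin k → Fin m → A
replace f i₀ j₀ x i j with i Fin.≟ i₀ | j Fin.≟ j₀
... | yes _ | yes _ = x
... | _     | _     = f i j

replace-here : ∀ {A : Set} {k m} (f : Fin k → Fin m → A) i₀ j₀ x → replace f i₀ j₀ x i₀ j₀ ≡ x
replace-here f i₀ j₀ x with i₀ Fin.≟ i₀ | j₀ Fin.≟ j₀
... | yes _  | yes _  = ≡.refl
... | yes _  | no j≢j = ⊥-elim (j≢j ≡.refl)
... | no i≢i | _      = ⊥-elim (i≢i ≡.refl)

replace-there : ∀ {A : Set} {k m} (f : Fin k → Fin m → A) i₀ j₀ x i j → ¬ (i ≡ i₀ × j ≡ j₀) →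
                replace f i₀ j₀ x i j ≡ f i j
replace-there f i₀ j₀ x i j ij≢ with i Fin.≟ i₀ | j Fin.≟ j₀
... | yes i≡ | yes j≡ = ⊥-elim (ij≢ (i≡ , j≡))
... | yes _  | no _   = ≡.refl
... | no _   | _      = ≡.refl

-- Positive w is the constructive 0 < w, a bound away from 0; it does not follow from ¬ w ≤ 0.
record OrderedSemiring : Set₁ where
  field
    commutativeSemiring : CommutativeSemiring 0ℓ 0ℓ
  open CommutativeSemiring commutativeSemiring public
  infix 4 _≤_
  field
    _≤_          : Carrier → Carrier → Set
    ≤-reflexive  : ∀ {x y} → x ≈ y → x ≤ y
    ≤-trans      : ∀ {x y z} → x ≤ y → y ≤ z → x ≤ z
    ≤-antisym    : ∀ {x y} → x ≤ y → y ≤ x → x ≈ y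
    +-mono-≤     : ∀ {x y u v} → x ≤ y → u ≤ v → x + u ≤ y + v
    +-cancelˡ-≤  : ∀ {x y} z → z + x ≤ z + y → x ≤ y
    *-monoˡ-≤    : ∀ {x y} w → 0# ≤ w → x ≤ y → w * x ≤ w * y
    Positive     : Carrier → Set
    *-cancelˡ-≤  : ∀ {x y} w → Positive w → w * x ≤ w * y → x ≤ y
    positive⇒0≤  : ∀ {w} → Positive w → 0# ≤ w
    0≤1          : 0# ≤ 1#
    1≉0          : ¬ 1# ≈ 0#

module OrderedSums (R : OrderedSemiring) where
  open OrderedSemiring R public hiding (zero)
  open SemiringSum semiring public
  open SetoidReasoning setoid

  ≤-resp-≈ : ∀ {x x′ y y′} → x ≈ x′ → y ≈ y′ → x ≤ y → x′ ≤ y′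
  ≤-resp-≈ x≈x′ y≈y′ x≤y = ≤-trans (≤-reflexive (sym x≈x′)) (≤-trans x≤y (≤-reflexive y≈y′))

  sum-mono-≤ : ∀ {n} {f g : Vector Carrier n} → (∀ i → f i ≤ g i) → sum f ≤ sum g
  sum-mono-≤ {zero}  f≤g = ≤-reflexive refl
  sum-mono-≤ {suc n} f≤g = +-mono-≤ (f≤g zero) (sum-mono-≤ (f≤g ∘ suc))

  sum₂-cong : ∀ {k m} {f g : Fin k → Fin m → Carrier} → (∀ i j → f i j ≈ g i j) →
              sum (λ i → sum (f i)) ≈ sum (λ i → sum (g i))
  sum₂-cong f≈g = sum-cong-≋ λ i → sum-cong-≋ (f≈g i)

  sum₃-cong : ∀ {k m n} {f g : Fin k → Fin m → Fin n → Carrier} → (∀ i j l → f i j l ≈ g i j l) →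
              sum (λ i → sum (λ j → sum (f i j))) ≈ sum (λ i → sum (λ j → sum (g i j)))
  sum₃-cong f≈g = sum₂-cong λ i j → sum-cong-≋ (f≈g i j)

  sum₂-flatten : ∀ {k m} {x : Carrier} {y : Fin k → Carrier} {z u : Fin k → Fin m → Carrier} →
                 x ≈ sum y → (∀ i → y i ≈ sum (z i)) → (∀ i j → z i j ≈ u i j) →
                 x ≈ sum (λ i → sum (u i))
  sum₂-flatten x≈ y≈ z≈ = trans x≈ (sum-cong-≋ λ i → trans (y≈ i) (sum-cong-≋ (z≈ i)))

  sum-single : ∀ {n} (f : Vector Carrier n) i → (∀ j → j ≢ i → f j ≈ 0#) → sum f ≈ f i
  sum-single {suc n} f i f≈0 = begin
    sum f                       ≈⟨ sum-remove f ⟩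
    f i + sum (removeAt f i)    ≈⟨ +-congˡ (sum-cong-≋ λ j → f≈0 (punchIn i j) (Finₚ.punchInᵢ≢i i j)) ⟩
    f i + sum {n} (λ _ → 0#)    ≈⟨ +-congˡ (sum-replicate-zero n) ⟩
    f i + 0#                    ≈⟨ +-identityʳ (f i) ⟩
    f i                         ∎

  -- Passes from an inequality of totals to one of single terms without subtraction: once the other
  -- terms of `f` are enlarged to those of `g`, both sides share a summand that cancels.
  sum-cancel-≤ : ∀ {n} (f g : Vector Carrier n) i → (∀ j → j ≢ i → f j ≤ g j) → sum g ≤ sum f → g i ≤ f i
  sum-cancel-≤ {suc n} f g i f≤g Σg≤Σf = +-cancelˡ-≤ (sum (removeAt g i)) (≤-trans
    (≤-resp-≈ (trans (sum-remove g) (+-comm _ _)) (sum-remove f) Σg≤Σf)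
    (≤-trans (≤-reflexive (+-comm _ _))
      (+-mono-≤ (sum-mono-≤ λ j → f≤g (punchIn i j) (Finₚ.punchInᵢ≢i i j)) (≤-reflexive refl))))

  sum₂-cancel-≤ : ∀ {k m} (f g : Fin k → Fin m → Carrier) i₀ j₀ →
                  (∀ i j → ¬ (i ≡ i₀ × j ≡ j₀) → f i j ≤ g i j) →
                  sum (λ i → sum (g i)) ≤ sum (λ i → sum (f i)) → g i₀ j₀ ≤ f i₀ j₀
  sum₂-cancel-≤ f g i₀ j₀ f≤g Σg≤Σf =
    sum-cancel-≤ (f i₀) (g i₀) j₀ (λ j j≢ → f≤g i₀ j (j≢ ∘ proj₂))
      (sum-cancel-≤ (sum ∘ f) (sum ∘ g) i₀ (λ i i≢ → sum-mono-≤ λ j → f≤g i j (i≢ ∘ proj₁)) Σg≤Σf)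

  indicator : ∀ {n} → Fin n → Vector Carrier n
  indicator a b with a Fin.≟ b
  ... | yes _ = 1#
  ... | no _  = 0#

  indicator-here : ∀ {n} (a : Fin n) → indicator a a ≈ 1#
  indicator-here a with a Fin.≟ a
  ... | yes _  = refl
  ... | no a≢a = ⊥-elim (a≢a ≡.refl)

  indicator-there : ∀ {n} (a b : Fin n) → b ≢ a → indicator a b ≈ 0#
  indicator-there a b b≢a with a Fin.≟ b
  ... | yes a≡b = ⊥-elim (b≢a (≡.sym a≡b))
  ... | no _    = refl

  indicator-nonneg : ∀ {n} (a b : Fin n) → 0# ≤ indicator a b
  indicator-nonneg a b with a Fin.≟ b
  ... | yes _ = 0≤1
  ... | no _  = ≤-reflexive refl

  sum-concentrated : ∀ {n} (w g : Vector Carrier n) a → w a ≈ 1# → (∀ b → b ≢ a → w b ≈ 0#) →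
                     sum (λ b → w b * g b) ≈ g a
  sum-concentrated w g a wa≈1 wb≈0 = begin
    sum (λ b → w b * g b) ≈⟨ sum-single _ a (λ b b≢a → trans (*-congʳ (wb≈0 b b≢a)) (zeroˡ (g b))) ⟩
    w a * g a             ≈⟨ *-congʳ wa≈1 ⟩
    1# * g a              ≈⟨ *-identityˡ (g a) ⟩
    g a                   ∎

  sum-indicator : ∀ {n} (a : Fin n) (g : Vector Carrier n) → sum (λ b → indicator a b * g b) ≈ g a
  sum-indicator a g = sum-concentrated (indicator a) g a (indicator-here a) (indicator-there a)

  Weights : ∀ {n} → Vector Carrier n → Set
  Weights w = (∀ b → 0# ≤ w b) × sum w ≈ 1#

  indicator-weights : ∀ {n} (a : Fin n) → Weights (indicator a)
  indicator-weights a = indicator-nonneg a ,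
    trans (sum-single (indicator a) a (indicator-there a)) (indicator-here a)

  average-of-constant : ∀ {n} {w : Vector Carrier n} → Weights w → ∀ t → sum (λ b → w b * t) ≈ t
  average-of-constant {w = w} (_ , Σw≈1) t = begin
    sum (λ b → w b * t)  ≈⟨ *-distribʳ-sum t w ⟨
    sum w * t            ≈⟨ *-congʳ Σw≈1 ⟩
    1# * t               ≈⟨ *-identityˡ t ⟩
    t                    ∎

  average-≤ : ∀ {n} {w g : Vector Carrier n} {t} → Weights w → (∀ b → g b ≤ t) → sum (λ b → w b * g b) ≤ t
  average-≤ {w = w} {t = t} W g≤t = ≤-trans (sum-mono-≤ λ b → *-monoˡ-≤ (w b) (proj₁ W b) (g≤t b))
    (≤-reflexive (average-of-constant W t))

  -- The terms are bounded by `w b * t`, and these bounds sum to `t`, so an average of at least `t`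
  -- leaves no slack in any term. The factor `w b` stays because it may vanish.
  average-extremal : ∀ {n} {w g : Vector Carrier n} {t} → Weights w → (∀ b → g b ≤ t) →
                     t ≤ sum (λ b → w b * g b) → ∀ b → w b * t ≤ w b * g b
  average-extremal {w = w} {g} {t} W g≤t t≤avg b = sum-cancel-≤ (λ b → w b * g b) (λ b → w b * t) b
    (λ b′ _ → *-monoˡ-≤ (w b′) (proj₁ W b′) (g≤t b′))
    (≤-trans (≤-reflexive (average-of-constant W t)) t≤avg)

  infix 4 _≪_
  _≪_ : Carrier → Carrier → Set
  x ≪ y = ∃ λ d → Positive d × x + d ≈ y

  ≪⇒≤ : ∀ {x y} → x ≪ y → x ≤ y
  ≪⇒≤ {x} (d , d>0 , x+d≈y) =
    ≤-resp-≈ (+-identityʳ x) x+d≈y (+-mono-≤ (≤-reflexive refl) (positive⇒0≤ d>0))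

  ≪-resp-≈ : ∀ {x x′ y y′} → x ≈ x′ → y ≈ y′ → x ≪ y → x′ ≪ y′
  ≪-resp-≈ x≈x′ y≈y′ (d , d>0 , x+d≈y) = d , d>0 , trans (+-congʳ (sym x≈x′)) (trans x+d≈y y≈y′)

  -- Writing `y` as `x + d` and cancelling `w * x` leaves `w * d ≤ 0#`; the positive gap `d` can
  -- then be cancelled.
  vanishing-weight : ∀ {w x y} → 0# ≤ w → x ≪ y → w * y ≤ w * x → w ≈ 0#
  vanishing-weight {w} {x} {y} 0≤w (d , d>0 , x+d≈y) wy≤wx = ≤-antisym
    (*-cancelˡ-≤ d d>0 (≤-resp-≈ (*-comm w d) (sym (zeroʳ d))
      (+-cancelˡ-≤ (w * x) (≤-resp-≈
        (trans (*-congˡ (sym x+d≈y)) (distribˡ w x d)) (sym (+-identityʳ (w * x))) wy≤wx))))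
    0≤w

-- Maximizers over Minkowski sums of convex hulls

module MinkowskiSum (R : OrderedSemiring) {rows cols k m n : ℕ} where
  open OrderedSums R
  open SetoidReasoning setoid

  Coords : Set
  Coords = Fin rows → Fin cols → Carrier

  infix 4 _≋_
  _≋_ : Coords → Coords → Set
  x ≋ y = ∀ r s → x r s ≈ y r s

  dot : Coords → Coords → Carrier
  dot c x = sum λ r → sum λ s → c r s * x r s

  dot-cong : ∀ c {x y} → x ≋ y → dot c x ≈ dot c y
  dot-cong c x≋y = sum₂-cong λ r s → *-congˡ (x≋y r s)

  dot-∑ : ∀ {l} c (f : Fin l → Coords) → dot c (λ r s → sum λ i → f i r s) ≈ sum λ i → dot c (f i)
  dot-∑ c f = begin
    sum (λ r → sum λ s → c r s * sum λ i → f i r s)   ≈⟨ sum₂-cong (λ r s → *-distribˡ-sum (c r s) (λ i → f i r s)) ⟩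
    sum (λ r → sum λ s → sum λ i → c r s * f i r s)   ≈⟨ sum-cong-≋ (λ r → ∑-comm (λ s i → c r s * f i r s)) ⟩
    sum (λ r → sum λ i → sum λ s → c r s * f i r s)   ≈⟨ ∑-comm (λ r i → sum λ s → c r s * f i r s) ⟩
    sum (λ i → sum λ r → sum λ s → c r s * f i r s)   ∎

  dot-scale : ∀ c t x → dot c (λ r s → t * x r s) ≈ t * dot c x
  dot-scale c t x = begin
    sum (λ r → sum λ s → c r s * (t * x r s))   ≈⟨ sum₂-cong (λ r s → x∙yz≈y∙xz (c r s) t (x r s)) ⟩
    sum (λ r → sum λ s → t * (c r s * x r s))   ≈⟨ sum-cong-≋ (λ r → *-distribˡ-sum t (λ s → c r s * x r s)) ⟨
    sum (λ r → t * sum λ s → c r s * x r s)     ≈⟨ *-distribˡ-sum t (λ r → sum λ s → c r s * x r s) ⟨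
    t * dot c x                                 ∎
    where open CommutativeSemigroupProperties *-commutativeSemigroup using (x∙yz≈y∙xz)

  dot-unit : ∀ c x r s → x r s ≈ 1# → (∀ r′ s′ → ¬ (r′ ≡ r × s′ ≡ s) → x r′ s′ ≈ 0#) → dot c x ≈ c r s
  dot-unit c x r s x-here x-there = begin
    dot c x                     ≈⟨ sum-single _ r (λ r′ r′≢r → trans
                                     (sum-cong-≋ λ s′ → vanishes (x-there r′ s′ (r′≢r ∘ proj₁)))
                                     (sum-replicate-zero cols)) ⟩
    sum (λ s → c r s * x r s)   ≈⟨ sum-single _ s (λ s′ s′≢s → vanishes (x-there r s′ (s′≢s ∘ proj₂))) ⟩
    c r s * x r s               ≈⟨ *-congˡ x-here ⟩
    c r s * 1#                  ≈⟨ *-identityʳ (c r s) ⟩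
    c r s                       ∎
    where
    vanishes : ∀ {r s} → x r s ≈ 0# → c r s * x r s ≈ 0#
    vanishes x≈0 = trans (*-congˡ x≈0) (zeroʳ _)

  module _ (p : Fin k → Fin m → Fin n → Coords) where

    Weighting : Set
    Weighting = Fin k → Fin m → Vector Carrier n

    combination : Weighting → Coords
    combination w r s = sum λ i → sum λ j → sum λ b → w i j b * p i j b r s

    infix 4 _∈Sum
    _∈Sum : Coords → Set
    x ∈Sum = Σ Weighting λ w → (∀ i j → Weights (w i j)) × x ≋ combination w

    chosen : (Fin k → Fin m → Fin n) → Coords
    chosen a r s = sum λ i → sum λ j → p i j (a i j) r s

    chosen≋ : ∀ a → chosen a ≋ combination (λ i j → indicator (a i j))
    chosen≋ a r s = sum₂-cong λ i j → sym (sum-indicator (a i j) (λ b → p i j b r s))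

    chosen-cong : ∀ {a a′} → (∀ i j → a i j ≡ a′ i j) → chosen a ≋ chosen a′
    chosen-cong a≡a′ r s = sum₂-cong λ i j → reflexive (≡.cong (λ b → p i j b r s) (a≡a′ i j))

    chosen∈Sum : ∀ a → chosen a ∈Sum
    chosen∈Sum a = (λ i j → indicator (a i j)) , (λ i j → indicator-weights (a i j)) , chosen≋ a

    record UniqueMaximizer (c v : Coords) : Set where
      constructor maximizer
      field
        member  : v ∈Sum
        maximal : ∀ x → x ∈Sum → dot c x ≤ dot c v
        unique  : ∀ x → x ∈Sum → dot c x ≈ dot c v → x ≋ v

    module _ (c : Coords) where

      value : Fin k → Fin m → Vector Carrier n
      value i j b = dot c (p i j b)

      average : Weighting → Fin k → Fin m → Carrier
      average w i j = sum λ b → w i j b * value i j b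

      dot-combination : ∀ w → dot c (combination w) ≈ sum λ i → sum λ j → average w i j
      dot-combination w = begin
        dot c (combination w)
          ≈⟨ dot-∑ c (λ i r s → sum λ j → sum λ b → w i j b * p i j b r s) ⟩
        sum (λ i → dot c λ r s → sum λ j → sum λ b → w i j b * p i j b r s)
          ≈⟨ sum-cong-≋ (λ i → dot-∑ c (λ j r s → sum λ b → w i j b * p i j b r s)) ⟩
        sum (λ i → sum λ j → dot c λ r s → sum λ b → w i j b * p i j b r s)
          ≈⟨ sum₂-cong (λ i j → dot-∑ c (λ b r s → w i j b * p i j b r s)) ⟩
        sum (λ i → sum λ j → sum λ b → dot c λ r s → w i j b * p i j b r s)
          ≈⟨ sum₃-cong (λ i j b → dot-scale c (w i j b) (p i j b)) ⟩
        sum (λ i → sum λ j → average w i j) ∎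

      dot-chosen : ∀ a → dot c (chosen a) ≈ sum λ i → sum λ j → value i j (a i j)
      dot-chosen a = begin
        dot c (chosen a)
          ≈⟨ dot-cong c (chosen≋ a) ⟩
        dot c (combination (λ i j → indicator (a i j)))
          ≈⟨ dot-combination (λ i j → indicator (a i j)) ⟩
        sum (λ i → sum λ j → average (λ i j → indicator (a i j)) i j)
          ≈⟨ sum₂-cong (λ i j → sum-indicator (a i j) (value i j)) ⟩
        sum (λ i → sum λ j → value i j (a i j)) ∎

      -- A maximizer only yields WeakTop, since ¬ y ≤ x need not give a positive gap; conversely a
      -- gap is what makes the chosen point the unique maximizer.
      record Top (a : Fin k → Fin m → Fin n) : Set where
        constructor top
        field dominates : ∀ i j b → b ≢ a i j → value i j b ≪ value i j (a i j)

      record WeakTop (a : Fin k → Fin m → Fin n) : Set where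
        constructor weakTop
        field dominates : ∀ i j b → b ≢ a i j → value i j b ≤ value i j (a i j) × ¬ value i j (a i j) ≤ value i j b

      module _ (a : Fin k → Fin m → Fin n) (a-top : Top a) where
        open Top a-top

        top-≤ : ∀ i j b → value i j b ≤ value i j (a i j)
        top-≤ i j b with b Fin.≟ a i j
        ... | yes ≡.refl = ≤-reflexive refl
        ... | no b≢a     = ≪⇒≤ (dominates i j b b≢a)

        chosen-maximal : ∀ x → x ∈Sum → dot c x ≤ dot c (chosen a)
        chosen-maximal x (w , W , x≋) = ≤-resp-≈
          (sym (trans (dot-cong c x≋) (dot-combination w))) (sym (dot-chosen a))
          (sum-mono-≤ λ i → sum-mono-≤ λ j → average-≤ (W i j) (top-≤ i j))

        -- A total that reaches the maximum forces every simplex, and then every corner within it,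
        -- to lose nothing. Since a corner off the top has a positive gap, it can only carry weight
        -- zero.
        off-top-weights : ∀ w → (∀ i j → Weights (w i j)) → dot c (chosen a) ≤ dot c (combination w) →
                          ∀ i j b → b ≢ a i j → w i j b ≈ 0#
        off-top-weights w W a≤w i j b b≢a = vanishing-weight (proj₁ (W i j) b) (dominates i j b b≢a)
          (average-extremal (W i j) (top-≤ i j)
            (sum₂-cancel-≤ (average w) (λ i j → value i j (a i j)) i j
              (λ i j _ → average-≤ (W i j) (top-≤ i j))
              (≤-resp-≈ (dot-chosen a) (dot-combination w) a≤w)) b)

        chosen-unique : ∀ x → x ∈Sum → dot c x ≈ dot c (chosen a) → x ≋ chosen a
        chosen-unique x (w , W , x≋) x≈a r s = trans (x≋ r s) (sum₂-cong λ i j →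
          sum-concentrated (w i j) (λ b → p i j b r s) (a i j)
            (trans (sym (sum-single (w i j) (a i j) (vanish i j))) (proj₂ (W i j)))
            (vanish i j))
          where
          vanish = off-top-weights w W (≤-reflexive (trans (sym x≈a) (dot-cong c x≋)))

        chosen-maximizer : UniqueMaximizer c (chosen a)
        chosen-maximizer = maximizer (chosen∈Sum a) chosen-maximal chosen-unique

        -- If `a′` differed from `a` at some simplex, its indicator weights would put weight `1#` on
        -- a corner off the top, where `off-top-weights` demands zero. Only `a` has to be a top
        -- choice.
        chosen-injective : ∀ a′ → chosen a′ ≋ chosen a → ∀ i j → a′ i j ≡ a i j
        chosen-injective a′ a′≋a i j with a′ i j Fin.≟ a i j
        ... | yes eq = eq
        ... | no a′≢a = ⊥-elim (1≉0 (trans (sym (indicator-here (a′ i j)))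
          (off-top-weights (λ i j → indicator (a′ i j)) (λ i j → indicator-weights (a′ i j))
            (≤-reflexive (sym (dot-cong c (λ r s → trans (sym (chosen≋ a′ r s)) (a′≋a r s)))))
            i j (a′ i j) a′≢a)))

      module _ (x : Coords) (x-maximal : ∀ y → y ∈Sum → dot c y ≤ dot c x)
               (x-unique : ∀ y → y ∈Sum → dot c y ≈ dot c x → y ≋ x)
               (w : Weighting) (W : ∀ i j → Weights (w i j)) (x≋ : x ≋ combination w)
               (a : Fin k → Fin m → Fin n) (a-charged : ∀ i j → Positive (w i j (a i j))) where

        dot-x : dot c x ≈ sum λ i → sum λ j → average w i j
        dot-x = trans (dot-cong c x≋) (dot-combination w)

        -- Moving all the weight of one simplex to the corner `b` gives another point of the sum.
        -- Maximality compares the totals, and all other simplices contribute the same to both.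
        value≤average : ∀ i j b → value i j b ≤ average w i j
        value≤average i j b = ≤-resp-≈
          (trans (reflexive (≡.cong (λ v → sum λ b → v b * value i j b) (replace-here w i j (indicator b))))
                 (sum-indicator b (value i j)))
          refl
          (sum₂-cancel-≤ (average w) (average w′) i j
            (λ i′ j′ ij≢ → ≤-reflexive (reflexive
              (≡.cong (λ v → sum λ b → v b * value i′ j′ b) (≡.sym (replace-there w i j (indicator b) i′ j′ ij≢)))))
            (≤-resp-≈ (dot-combination w′) dot-x
              (x-maximal (combination w′) (w′ , W′ , λ r s → refl))))
          where
          w′ : Weighting
          w′ = replace w i j (indicator b)
          W′ : ∀ i′ j′ → Weights (w′ i′ j′)
          W′ i′ j′ with i′ Fin.≟ i | j′ Fin.≟ j
          ... | yes _ | yes _ = indicator-weights b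
          ... | yes _ | no _  = W i′ j′
          ... | no _  | _     = W i′ j′

        -- No value exceeds the average, so `average-extremal` applies with the average itself as
        -- the bound; the positive weight of the charged corner can then be cancelled. This locates
        -- a maximal corner without comparing values.
        charged≈average : ∀ i j → value i j (a i j) ≈ average w i j
        charged≈average i j = ≤-antisym (value≤average i j (a i j))
          (*-cancelˡ-≤ (w i j (a i j)) (a-charged i j)
            (average-extremal (W i j) (value≤average i j) (≤-reflexive refl) (a i j)))

        charged-≤ : ∀ i j b → value i j b ≤ value i j (a i j)
        charged-≤ i j b = ≤-trans (value≤average i j b) (≤-reflexive (sym (charged≈average i j)))

        same-value⇒≋ : ∀ a′ → (∀ i j → value i j (a′ i j) ≈ value i j (a i j)) → chosen a′ ≋ x
        same-value⇒≋ a′ same = x-unique (chosen a′) (chosen∈Sum a′) (begin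
          dot c (chosen a′)                          ≈⟨ dot-chosen a′ ⟩
          sum (λ i → sum λ j → value i j (a′ i j))   ≈⟨ sum₂-cong (λ i j → trans (same i j) (charged≈average i j)) ⟩
          sum (λ i → sum λ j → average w i j)        ≈⟨ dot-x ⟨
          dot c x                                    ∎)

        x≋chosen : chosen a ≋ x
        x≋chosen = same-value⇒≋ a λ i j → refl

        -- Were a tie possible, exchanging b for a i j alone would give a second maximizer.
        charged-strict : (∀ i j b b′ → p i j b ≋ p i j b′ → b ≡ b′) →
                         ∀ i j b → b ≢ a i j → ¬ value i j (a i j) ≤ value i j b
        -- Both choices yield `x` and differ in one summand only, so cancelling the others
        -- identifies the corners `b` and `a i j`. Cancellation is available for `≤` only, hence the
        -- two halves joined by `≤-antisym`.
        charged-strict p-injective i j b b≢a a≤b = b≢a (p-injective i j b (a i j) λ r s →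
          trans (reflexive (≡.cong (λ b → p i j b r s) (≡.sym here)))
            (≤-antisym (cancel (λ i j → p i j (a i j) r s) (λ i j → p i j (a′ i j) r s)
                         (λ i′ j′ ij≢ → reflexive (≡.cong (λ b → p i′ j′ b r s) (≡.sym (there i′ j′ ij≢))))
                         (trans (same-value⇒≋ a′ same r s) (sym (x≋chosen r s))))
                       (cancel (λ i j → p i j (a′ i j) r s) (λ i j → p i j (a i j) r s)
                         (λ i′ j′ ij≢ → reflexive (≡.cong (λ b → p i′ j′ b r s) (there i′ j′ ij≢)))
                         (trans (x≋chosen r s) (sym (same-value⇒≋ a′ same r s))))))
          where
          a′ = replace a i j b
          here : a′ i j ≡ b
          here = replace-here a i j b
          there : ∀ i′ j′ → ¬ (i′ ≡ i × j′ ≡ j) → a′ i′ j′ ≡ a i′ j′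
          there = replace-there a i j b
          cancel : ∀ (f g : Fin k → Fin m → Carrier) → (∀ i′ j′ → ¬ (i′ ≡ i × j′ ≡ j) → f i′ j′ ≈ g i′ j′) →
                   sum (λ i → sum (g i)) ≈ sum (λ i → sum (f i)) → g i j ≤ f i j
          cancel f g f≈g Σg≈Σf =
            sum₂-cancel-≤ f g i j (λ i′ j′ ij≢ → ≤-reflexive (f≈g i′ j′ ij≢)) (≤-reflexive Σg≈Σf)
          same : ∀ i′ j′ → value i′ j′ (a′ i′ j′) ≈ value i′ j′ (a i′ j′)
          same i′ j′ with i′ Fin.≟ i | j′ Fin.≟ j
          ... | yes ≡.refl | yes ≡.refl = ≤-antisym (charged-≤ i j b) a≤b
          ... | yes _      | no _       = refl
          ... | no _       | _          = refl

      maximizer-chosen : (∀ w → Weights w → ∃ λ b → Positive (w b)) →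
                         (∀ i j b b′ → p i j b ≋ p i j b′ → b ≡ b′) →
                         ∀ x → UniqueMaximizer c x → ∃ λ a → chosen a ≋ x × WeakTop a
      maximizer-chosen positive-weight p-injective x (maximizer (w , W , x≋) x-maximal x-unique) = a
        , x≋chosen x x-maximal x-unique w W x≋ a charged
        , weakTop λ i j b b≢a → charged-≤ x x-maximal x-unique w W x≋ a charged i j b
                      , charged-strict x x-maximal x-unique w W x≋ a charged p-injective i j b b≢a
        where
        a : Fin k → Fin m → Fin n
        a i j = proj₁ (positive-weight (w i j) (W i j))
        charged : ∀ i j → Positive (w i j (a i j))
        charged i j = proj₂ (positive-weight (w i j) (W i j))

open ≡ using (refl; sym; trans; cong; cong₂; subst; subst₂)

-- The transfer automaton

BoolMatrix : ℕ → Set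
BoolMatrix n = Vec (Vec Bool n) n

entry : ∀ {n} → BoolMatrix n → Fin n → Fin n → Bool
entry R p q = lookup (lookup R p) q

matrix : ∀ {n} → (Fin n → Fin n → Bool) → BoolMatrix n
matrix r = Vec.tabulate λ p → Vec.tabulate (r p)

_∈ᵇ_ : ∀ {n} → Fin n × Fin n → List (Fin n × Fin n) → Bool
pq ∈ᵇ es = isYes (_∈?_ (≡-dec Fin._≟_ Fin._≟_) pq es)

-- One pass of Warshall's algorithm: admit k as an intermediate point.
through : ∀ {n} → BoolMatrix n → Fin n → BoolMatrix n
through R k = matrix λ p q → entry R p q ∨ (entry R p k ∧ entry R k q)

closure : ∀ {n} → List (Fin n × Fin n) → BoolMatrix n
closure es = foldl through (matrix λ p q → (p , q) ∈ᵇ es) (allFin _)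

entry-matrix : ∀ {n} (r : Fin n → Fin n → Bool) p q → entry (matrix r) p q ≡ r p q
entry-matrix r p q = trans
  (cong (λ row → lookup row q) (Vecₚ.lookup∘tabulate (λ p → Vec.tabulate (r p)) p))
  (Vecₚ.lookup∘tabulate (r p) q)

Increasing : ∀ {A : Set} → (A → A → Set) → ∀ {n} → BoolMatrix n → (Fin n → A) → Set
Increasing _≺_ R u = ∀ p q → T (entry R p q) → u p ≺ u q

module _ {A : Set} (_≺_ : A → A → Set) (≺-trans : ∀ {x y z} → x ≺ y → y ≺ z → x ≺ z)
         {n} (u : Fin n → A) where

  through-increasing : ∀ R k → Increasing _≺_ R u → Increasing _≺_ (through R k) u
  through-increasing R k inc p q h
    with Equivalence.to Boolₚ.T-∨ (subst T (entry-matrix _ p q) h)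
  ... | inj₁ pq = inc p q pq
  ... | inj₂ pkq with Equivalence.to Boolₚ.T-∧ pkq
  ...   | pk , kq = ≺-trans (inc p k pk) (inc k q kq)

  -- The general facts about `closure` are this soundness and the inclusion of the edges. That its
  -- result is transitive is verified by evaluation for each matrix that occurs, as part of
  -- `Transition`.
  closure-increasing : ∀ es → All (λ (p , q) → u p ≺ u q) es → Increasing _≺_ (closure es) u
  closure-increasing es inc = go (allFin n) _ λ p q h →
    All.lookup inc (toWitness (subst T (entry-matrix _ p q) h))
    where
    go : ∀ ks R → Increasing _≺_ R u → Increasing _≺_ (foldl through R ks) u
    go []       R incR = incR
    go (k ∷ ks) R incR = go ks (through R k) (through-increasing R k incR)

edge⇒closure : ∀ {n} (es : List (Fin n × Fin n)) {p q} → (p , q) ∈ₗ es → T (entry (closure es) p q)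
edge⇒closure es {p} {q} pq∈es =
  go (allFin _) _ (subst T (sym (entry-matrix _ p q)) (fromWitness pq∈es))
  where
  go : ∀ ks R → T (entry R p q) → T (entry (foldl through R ks) p q)
  go []       R h = h
  go (k ∷ ks) R h = go ks (through R k)
    (subst T (sym (entry-matrix _ p q)) (Equivalence.from Boolₚ.T-∨ (inj₁ h)))

-- Extending strictly increasing rational heights

⊔-lub-< : ∀ {p q r} → p ℚ.< r → q ℚ.< r → p ℚ.⊔ q ℚ.< r
⊔-lub-< {p} {q} {r} p<r q<r with ℚₚ.⊔-sel p q
... | inj₁ eq = subst (ℚ._< r) (sym eq) p<r
... | inj₂ eq = subst (ℚ._< r) (sym eq) q<r

⊓-glb-< : ∀ {p q r} → r ℚ.< p → r ℚ.< q → r ℚ.< p ℚ.⊓ q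
⊓-glb-< {p} {q} {r} r<p r<q with ℚₚ.⊓-sel p q
... | inj₁ eq = subst (r ℚ.<_) (sym eq) r<p
... | inj₂ eq = subst (r ℚ.<_) (sym eq) r<q

lower-bound : ∀ {n} (v : Fin n → ℚ) → ∃ λ z → ∀ p → z ℚ.< v p
lower-bound {zero}  v = 0ℚ , λ ()
lower-bound {suc n} v with lower-bound (v ∘ suc)
... | z , z< = z ℚ.⊓ (v zero ℚ.- 1ℚ) , λ where
  zero    → ℚₚ.≤-<-trans (ℚₚ.p⊓q≤q z _) (subst (v zero ℚ.- 1ℚ ℚ.<_) (ℚₚ.+-identityʳ (v zero))
              (ℚₚ.+-monoʳ-< (v zero) (ℚₚ.negative⁻¹ (ℚ.- 1ℚ))))
  (suc p) → ℚₚ.≤-<-trans (ℚₚ.p⊓q≤p z _) (z< p)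

-- A running maximum of the marked values of `v`, started below all of `w` so that an empty set of
-- lower values is covered as well. The lower bound is weak here; `above` makes it strict.
last-below : ∀ {m n} (v : Fin m → ℚ) (w : Fin n → ℚ) (L : Fin m → Bool) (U : Fin n → Bool) →
             (∀ p q → T (L p) → T (U q) → v p ℚ.< w q) →
             ∃ λ z → (∀ p → T (L p) → v p ℚ.≤ z) × (∀ q → T (U q) → z ℚ.< w q)
last-below {zero}  v w L U L<U with lower-bound w
... | z , z< = z , (λ ()) , λ q _ → z< q
last-below {suc m} v w L U L<U with last-below (v ∘ suc) w (L ∘ suc) U (λ p q → L<U (suc p) q) | L zero in L₀
... | z , L≤z , z<U | false =
  z , (λ where zero p∈L → ⊥-elim (subst T L₀ p∈L) ; (suc p) p∈L → L≤z p p∈L) , z<U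
... | z , L≤z , z<U | true  = z ℚ.⊔ v zero
  , (λ where zero _ → ℚₚ.p≤q⊔p z (v zero) ; (suc p) p∈L → ℚₚ.≤-trans (L≤z p p∈L) (ℚₚ.p≤p⊔q z (v zero)))
  , λ q q∈U → ⊔-lub-< (z<U q q∈U) (L<U zero q (subst T (sym L₀) tt) q∈U)

-- Density keeps room above `y` each time a marked upper bound is added; with no bounds left,
-- `y ℚ.+ 1ℚ` serves.
above : ∀ {n} (w : Fin n → ℚ) (U : Fin n → Bool) y → (∀ q → T (U q) → y ℚ.< w q) →
        ∃ λ z → y ℚ.< z × (∀ q → T (U q) → z ℚ.< w q)
above {zero}  w U y y<U =
  y ℚ.+ 1ℚ , subst (ℚ._< y ℚ.+ 1ℚ) (ℚₚ.+-identityʳ y) (ℚₚ.+-monoʳ-< y (ℚₚ.positive⁻¹ 1ℚ)) , λ ()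
above {suc n} w U y y<U with above (w ∘ suc) (U ∘ suc) y (y<U ∘ suc) | U zero in U₀
... | z , y<z , z<U | false =
  z , y<z , λ where zero q∈U → ⊥-elim (subst T U₀ q∈U) ; (suc q) q∈U → z<U q q∈U
... | z , y<z , z<U | true with ℚₚ.<-dense y<z | ℚₚ.<-dense (y<U zero (subst T (sym U₀) tt))
...   | a , y<a , a<z | b , y<b , b<w₀ = a ℚ.⊓ b
  , ⊓-glb-< y<a y<b
  , λ where zero    _   → ℚₚ.≤-<-trans (ℚₚ.p⊓q≤q a b) b<w₀
            (suc q) q∈U → ℚₚ.<-trans (ℚₚ.≤-<-trans (ℚₚ.p⊓q≤p a b) a<z) (z<U q q∈U)

between : ∀ {n} (v : Fin n → ℚ) (L U : Fin n → Bool) →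
          (∀ p q → T (L p) → T (U q) → v p ℚ.< v q) →
          ∃ λ z → (∀ p → T (L p) → v p ℚ.< z) × (∀ q → T (U q) → z ℚ.< v q)
between v L U L<U with last-below v v L U L<U
... | y , L≤y , y<U with above v U y y<U
...   | z , y<z , z<U = z , (λ p p∈L → ℚₚ.≤-<-trans (L≤y p p∈L) y<z) , z<U

-- ℚ is dense without endpoints, so the new points can be inserted one at a time. Transitivity
-- through the inserted point puts the values required below it under those required above it, which
-- is what `between` needs.
extend : ∀ k {m} (R : Fin (k ℕ.+ m) → Fin (k ℕ.+ m) → Bool) →
         (∀ p → ¬ T (R p p)) → (∀ p q r → T (R p q) → T (R q r) → T (R p r)) →
         (u : Fin m → ℚ) → (∀ i j → T (R (k ↑ʳ i) (k ↑ʳ j)) → u i ℚ.< u j) →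
         Σ (Fin (k ℕ.+ m) → ℚ) λ v → (∀ p q → T (R p q) → v p ℚ.< v q) × (∀ j → v (k ↑ʳ j) ≡ u j)
extend zero    R irrefl R-trans u inc = u , inc , λ _ → refl
extend (suc k) R irrefl R-trans u inc
  with extend k (λ p q → R (suc p) (suc q)) (irrefl ∘ suc)
         (λ p q r → R-trans (suc p) (suc q) (suc r)) u inc
... | v , v-inc , v≡u
  with between v (λ p → R (suc p) zero) (λ q → R zero (suc q))
         (λ p q p0 0q → v-inc p q (R-trans (suc p) zero (suc q) p0 0q))
... | z , lower , upper = w , w-inc , v≡u
  where
  w : Fin (suc (k ℕ.+ _)) → ℚ
  w zero    = z
  w (suc p) = v p
  w-inc : ∀ p q → T (R p q) → w p ℚ.< w q
  w-inc zero    zero    zz = ⊥-elim (irrefl zero zz)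
  w-inc zero    (suc q) 0q = upper q 0q
  w-inc (suc p) zero    p0 = lower p p0
  w-inc (suc p) (suc q) pq = v-inc p q pq

-- States and transitions

State : Set
State = Fin 11

-- The eleven orders that the choices made so far can force on a column of three points;
-- a pair (i , j) puts i below j.
poset : State → List (Fin 3 × Fin 3)
poset = lookup
  ( []
  ∷ ((# 2 , # 1) ∷ [])
  ∷ ((# 1 , # 2) ∷ [])
  ∷ ((# 1 , # 0) ∷ (# 2 , # 0) ∷ [])
  ∷ ((# 1 , # 0) ∷ (# 2 , # 0) ∷ (# 2 , # 1) ∷ [])
  ∷ ((# 1 , # 0) ∷ [])
  ∷ ((# 1 , # 0) ∷ (# 1 , # 2) ∷ [])
  ∷ ((# 0 , # 2) ∷ (# 1 , # 2) ∷ [])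
  ∷ ((# 0 , # 1) ∷ (# 2 , # 1) ∷ [])
  ∷ ((# 0 , # 1) ∷ [])
  ∷ ((# 0 , # 1) ∷ (# 0 , # 2) ∷ (# 1 , # 2) ∷ [])
  ∷ [])

left right : Fin 3 → Fin 6
left  i = i ↑ˡ 3
right i = 3 ↑ʳ i

-- The corners come in the order in which `Δ` lists them, so a choice in `Fin 4` means the same
-- corner for the polytope and for the automaton.
corner₆ : Fin 2 → Fin 4 → Fin 6
corner₆ i = lookup (left (inject₁ i) ∷ right (inject₁ i) ∷ left (suc i) ∷ right (suc i) ∷ [])

squareEdges : Fin 2 → Fin 4 → List (Fin 6 × Fin 6)
squareEdges i a = tabulate λ k → corner₆ i (punchIn a k) , corner₆ i a

edges : State → Fin 4 → Fin 4 → List (Fin 6 × Fin 6)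
edges s x y =
  List.map (Product.map left left) (poset s) ++ squareEdges zero x ++ squareEdges (suc zero) y

side-by-side : ∀ {A : Set} → (Fin 3 → A) → (Fin 3 → A) → Fin 6 → A
side-by-side l r = [ l , r ] ∘ splitAt 3

side-left : ∀ {A : Set} (l r : Fin 3 → A) i → l i ≡ side-by-side l r (left i)
side-left l r zero             = refl
side-left l r (suc zero)       = refl
side-left l r (suc (suc zero)) = refl

side-by-side-η : ∀ {A : Set} (v : Fin 6 → A) r → (∀ i → v (right i) ≡ r i) →
                 ∀ p → v p ≡ side-by-side (v ∘ left) r p
side-by-side-η v r eq zero                = refl
side-by-side-η v r eq (suc zero)          = refl
side-by-side-η v r eq (suc (suc zero))    = refl
side-by-side-η v r eq (suc (suc (suc i))) = eq i

adjacent : ∀ {A : Set} {m} → (Fin (suc m) → Fin 3 → A) → Fin m → Fin 6 → A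
adjacent h j = side-by-side (h (inject₁ j)) (h (suc j))

module _ {A : Set} (_≺_ : A → A → Set) where

  Monotone : State → (Fin 3 → A) → Set
  Monotone s u = All (λ (i , j) → u i ≺ u j) (poset s)

  Dominates : (Fin 6 → A) → Fin 2 → Fin 4 → Set
  Dominates u i a = ∀ b → b ≢ a → u (corner₆ i b) ≺ u (corner₆ i a)

  Realizes : ∀ {m} → (Fin (suc m) → Fin 3 → A) → (Fin m → Fin 2 → Fin 4) → Set
  Realizes h a = ∀ j i → Dominates (adjacent h j) i (a j i)

  edges-increasing : ∀ s x y u → Monotone s (u ∘ left) → Dominates u zero x → Dominates u (suc zero) y →
                     All (λ (p , q) → u p ≺ u q) (edges s x y)
  edges-increasing s x y u mono dom₀ dom₁ = Allₚ.++⁺ (Allₚ.map⁺ mono)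
    (Allₚ.++⁺ (Allₚ.tabulate⁺ λ k → dom₀ (punchIn x k) (Finₚ.punchInᵢ≢i x k))
              (Allₚ.tabulate⁺ λ k → dom₁ (punchIn y k) (Finₚ.punchInᵢ≢i y k)))

  edges-increasing⁻ : ∀ s x y u → All (λ (p , q) → u p ≺ u q) (edges s x y) →
                      Monotone s (u ∘ left) × Dominates u zero x × Dominates u (suc zero) y
  edges-increasing⁻ s x y u inc with Allₚ.++⁻ (List.map _ (poset s)) inc
  ... | inc-left , inc′ with Allₚ.++⁻ (squareEdges zero x) inc′
  ...   | inc₀ , inc₁ = Allₚ.map⁻ inc-left , dominates zero x inc₀ , dominates (suc zero) y inc₁
    where
    dominates : ∀ i a → All (λ (p , q) → u p ≺ u q) (squareEdges i a) → Dominates u i a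
    dominates i a inc b b≢a = subst (λ c → u (corner₆ i c) ≺ u (corner₆ i a))
      (Finₚ.punchIn-punchOut (b≢a ∘ sym))
      (Allₚ.tabulate⁻ {f = λ k → corner₆ i (punchIn a k) , corner₆ i a} inc (Fin.punchOut (b≢a ∘ sym)))

-- Row s, column 4x + y: the state reached from s by the choices x and y, or 11 if they close a cycle.
table : Vec (Vec ℕ 16) 11
table =
    ( 0 ∷  1 ∷  0 ∷  2 ∷  3 ∷  4 ∷  5 ∷  6 ∷  0 ∷ 11 ∷  0 ∷  7 ∷ 11 ∷  8 ∷  9 ∷ 10 ∷ [])
  ∷ ( 0 ∷  1 ∷ 11 ∷  2 ∷  3 ∷  4 ∷ 11 ∷  6 ∷  0 ∷ 11 ∷ 11 ∷  7 ∷ 11 ∷  8 ∷ 11 ∷ 10 ∷ [])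
  ∷ (11 ∷  1 ∷  0 ∷  2 ∷ 11 ∷  4 ∷  5 ∷  6 ∷ 11 ∷ 11 ∷  0 ∷  7 ∷ 11 ∷  8 ∷  9 ∷ 10 ∷ [])
  ∷ ( 0 ∷  1 ∷  0 ∷  2 ∷  3 ∷  4 ∷  3 ∷  6 ∷ 11 ∷ 11 ∷ 11 ∷ 11 ∷ 11 ∷  8 ∷ 11 ∷ 10 ∷ [])
  ∷ ( 0 ∷  1 ∷ 11 ∷  2 ∷  3 ∷  4 ∷ 11 ∷  6 ∷ 11 ∷ 11 ∷ 11 ∷ 11 ∷ 11 ∷  8 ∷ 11 ∷ 10 ∷ [])
  ∷ ( 0 ∷  1 ∷  0 ∷  2 ∷  3 ∷  4 ∷  5 ∷  6 ∷ 11 ∷ 11 ∷ 11 ∷ 11 ∷ 11 ∷  8 ∷  9 ∷ 10 ∷ [])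
  ∷ (11 ∷  1 ∷  0 ∷  2 ∷ 11 ∷  4 ∷  5 ∷  6 ∷ 11 ∷ 11 ∷ 11 ∷ 11 ∷ 11 ∷  8 ∷  9 ∷ 10 ∷ [])
  ∷ (11 ∷ 11 ∷  0 ∷  7 ∷ 11 ∷  4 ∷  5 ∷  6 ∷ 11 ∷ 11 ∷  0 ∷  7 ∷ 11 ∷  8 ∷  9 ∷ 10 ∷ [])
  ∷ (11 ∷ 11 ∷ 11 ∷ 11 ∷  3 ∷  4 ∷ 11 ∷  6 ∷  0 ∷ 11 ∷ 11 ∷  7 ∷ 11 ∷  8 ∷ 11 ∷ 10 ∷ [])
  ∷ (11 ∷ 11 ∷ 11 ∷ 11 ∷  3 ∷  4 ∷  5 ∷  6 ∷  0 ∷ 11 ∷  0 ∷  7 ∷ 11 ∷  8 ∷  9 ∷ 10 ∷ [])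
  ∷ (11 ∷ 11 ∷ 11 ∷ 11 ∷ 11 ∷  4 ∷  5 ∷  6 ∷ 11 ∷ 11 ∷  0 ∷  7 ∷ 11 ∷  8 ∷  9 ∷ 10 ∷ [])
  ∷ []

next : State → Fin 4 → Fin 4 → Maybe State
next s x y with lookup (lookup table s) (Fin.combine x y) ℕ.<? 11
... | yes t<11 = just (Fin.fromℕ< t<11)
... | no  _    = nothing

-- The restriction to the right column must equal `poset t` exactly. That `poset t` is forced lets a
-- realized choice continue as a run from `t`; that nothing more is forced lets every `t`-monotone
-- right column be extended to the left.
Transition : BoolMatrix 6 → Maybe State → Set
Transition R nothing  = ∃ λ p → T (entry R p p)
Transition R (just t) =
  (∀ p → ¬ T (entry R p p)) ×
  (∀ p q r → T (entry R p q) → T (entry R q r) → T (entry R p r)) ×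
  (∀ i j → entry R (right i) (right j) ≡ (i , j) ∈ᵇ poset t)

transition? : ∀ R t → Dec (Transition R t)
transition? R nothing  = Finₚ.any? λ p → Boolₚ.T? _
transition? R (just t) =
  (Finₚ.all? λ p → ¬? (Boolₚ.T? _)) ×-dec
  (Finₚ.all? λ p → Finₚ.all? λ q → Finₚ.all? λ r → Boolₚ.T? _ →-dec Boolₚ.T? _ →-dec Boolₚ.T? _) ×-dec
  (Finₚ.all? λ i → Finₚ.all? λ j → _ Boolₚ.≟ _)

-- One finite check over the 11 · 16 steps certifies `table`: rejected steps do contain a cycle, and
-- each accepted step leads back to one of the eleven orders.
transition-closure : ∀ s x y → Transition (closure (edges s x y)) (next s x y)
transition-closure = from-yes (Finₚ.all? λ s → Finₚ.all? λ x → Finₚ.all? λ y →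
  transition? (closure (edges s x y)) (next s x y))

abstract
  order : State → Fin 4 → Fin 4 → BoolMatrix 6
  order s x y = closure (edges s x y)

  order-increasing : ∀ {A : Set} (_≺_ : A → A → Set) → (∀ {x y z} → x ≺ y → y ≺ z → x ≺ z) →
                     ∀ s x y u → All (λ (p , q) → u p ≺ u q) (edges s x y) → Increasing _≺_ (order s x y) u
  order-increasing _≺_ ≺-trans s x y u = closure-increasing _≺_ ≺-trans u (edges s x y)

  edge⇒order : ∀ s x y {p q} → (p , q) ∈ₗ edges s x y → T (entry (order s x y) p q)
  edge⇒order s x y = edge⇒closure (edges s x y)

  transition : ∀ s x y → Transition (order s x y) (next s x y)
  transition = transition-closure

-- Runs of the automaton and the heights that realize them

mutual
  Run : State → ℕ → Set
  Run s zero    = ⊤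
  Run s (suc m) = Σ (Fin 4) λ x → Σ (Fin 4) λ y → RunFrom (next s x y) m

  RunFrom : Maybe State → ℕ → Set
  RunFrom nothing  m = ⊥
  RunFrom (just t) m = Run t m

choices     : ∀ s m → Run s m → Fin m → Fin 2 → Fin 4
choicesFrom : ∀ t m → RunFrom t m → Fin m → Fin 2 → Fin 4
choices s (suc m) (x , y , r) zero zero       = x
choices s (suc m) (x , y , r) zero (suc zero) = y
choices s (suc m) (x , y , r) (suc j)         = choicesFrom (next s x y) m r j
choicesFrom (just t) m r = choices t m r

-- The automaton is deterministic: a run consists of its choices, and the intermediate states are
-- computed from them.
choices-injective     : ∀ s m r r′ → (∀ j i → choices s m r j i ≡ choices s m r′ j i) → r ≡ r′
choicesFrom-injective : ∀ t m r r′ → (∀ j i → choicesFrom t m r j i ≡ choicesFrom t m r′ j i) → r ≡ r′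
choices-injective s zero    tt          tt             eq = refl
choices-injective s (suc m) (x , y , r) (x′ , y′ , r′) eq with eq zero zero | eq zero (suc zero)
... | refl | refl with choicesFrom-injective (next s x y) m r r′ (eq ∘ suc)
...   | refl = refl
choicesFrom-injective (just t) m r r′ eq = choices-injective t m r r′ eq

module _ {A : Set} (_≺_ : A → A → Set) (≺-trans : ∀ {x y z} → x ≺ y → y ≺ z → x ≺ z)
         (≺-irrefl : ∀ {x} → ¬ x ≺ x) where

  -- The invariant is that the current column respects the order of the current state. A rejected
  -- step would place some point strictly below itself. No comparison is decided, so the relation
  -- may be one on Cauchy reals.
  realized-run : ∀ s m h a → Monotone _≺_ s (h zero) → Realizes _≺_ h a →
                 Σ (Run s m) λ r → ∀ j i → choices s m r j i ≡ a j i
  realized-run s zero    h a mono real = tt , λ ()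
  realized-run s (suc m) h a mono real = (x , y , proj₁ rest) , agree
    where
    x = a zero zero
    y = a zero (suc zero)
    u = side-by-side (h zero) (h (suc zero))
    left-mono : Monotone _≺_ s (u ∘ left)
    left-mono = All.map (λ {(i , j)} → subst₂ _≺_ (side-left _ _ i) (side-left _ _ j)) mono
    inc : Increasing _≺_ (order s x y) u
    inc = order-increasing _≺_ ≺-trans s x y u
      (edges-increasing _≺_ s x y u left-mono (real zero zero) (real zero (suc zero)))
    go : ∀ t → Transition (order s x y) t → Σ (RunFrom t m) λ r → ∀ j i → choicesFrom t m r j i ≡ a (suc j) i
    go nothing  (p , pp) = ⊥-elim (≺-irrefl (inc p p pp))
    go (just t) (_ , _ , restricts) = realized-run t m (h ∘ suc) (a ∘ suc)
      (All.tabulate λ {(i , j)} ij∈t → inc (right i) (right j)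
        (subst T (sym (restricts i j)) (fromWitness ij∈t)))
      (real ∘ suc)
    rest = go (next s x y) (transition s x y)
    agree : ∀ j i → choices s (suc m) (x , y , proj₁ rest) j i ≡ a j i
    agree zero    zero       = refl
    agree zero    (suc zero) = refl
    agree (suc j) i          = proj₂ rest j i

-- Counts the points below `j`. The listed orders are transitive, so this number grows strictly
-- along them and supplies heights for a column with nothing to its right.
rank : State → Fin 3 → ℕ
rank s j = List.length (List.filter (λ (_ , j′) → j′ Fin.≟ j) (poset s))

rank-monotone : ∀ s → Monotone ℕ._<_ s (rank s)
rank-monotone = from-yes (Finₚ.all? λ s → All.all? (λ (i , j) → rank s i ℕ.<? rank s j) (poset s))

ℕ⇒ℚ : ℕ → ℚ
ℕ⇒ℚ n = ℚ.mkℚ (+ n) 0 (Coprimality.sym (Coprimality.1-coprimeTo n))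

ℕ⇒ℚ-mono-< : ∀ {m n} → m ℕ.< n → ℕ⇒ℚ m ℚ.< ℕ⇒ℚ n
ℕ⇒ℚ-mono-< m<n = ℚ.*<* (subst₂ ℤ._<_ (sym (ℤₚ.*-identityʳ _)) (sym (ℤₚ.*-identityʳ _)) (ℤ.+<+ m<n))

left-column : ∀ s x y r (v : Fin 6 → ℚ) → Increasing ℚ._<_ (order s x y) v → (∀ i → v (right i) ≡ r i) →
              Σ (Fin 3 → ℚ) λ l → Monotone ℚ._<_ s l ×
                Dominates ℚ._<_ (side-by-side l r) zero x × Dominates ℚ._<_ (side-by-side l r) (suc zero) y
left-column s x y r v inc v≡r =
  v ∘ left , proj₁ parts , transfer zero x (proj₁ (proj₂ parts)) , transfer (suc zero) y (proj₂ (proj₂ parts))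
  where
  parts : Monotone ℚ._<_ s (v ∘ left) × Dominates ℚ._<_ v zero x × Dominates ℚ._<_ v (suc zero) y
  parts = edges-increasing⁻ ℚ._<_ s x y v
    (All.tabulate λ {(p , q)} pq∈E → inc p q (edge⇒order s x y pq∈E))
  transfer : ∀ i a → Dominates ℚ._<_ v i a → Dominates ℚ._<_ (side-by-side (v ∘ left) r) i a
  transfer i a dom b b≢a = subst₂ ℚ._<_
    (side-by-side-η v r v≡r (corner₆ i b)) (side-by-side-η v r v≡r (corner₆ i a)) (dom b b≢a)

-- The right column is prescribed and only has to respect `t`. As `t` is the whole restriction of
-- the acyclic transitive relation, the three left points can be inserted by `extend`.
extend-column : ∀ s x y t → Transition (order s x y) (just t) → ∀ r → Monotone ℚ._<_ t r →
                Σ (Fin 3 → ℚ) λ l → Monotone ℚ._<_ s l ×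
                  Dominates ℚ._<_ (side-by-side l r) zero x × Dominates ℚ._<_ (side-by-side l r) (suc zero) y
extend-column s x y t (acyclic , transitive , restricts) r mono =
  left-column s x y r (proj₁ extension) (proj₁ (proj₂ extension)) (proj₂ (proj₂ extension))
  where
  extension : Σ (Fin 6 → ℚ) λ v → Increasing ℚ._<_ (order s x y) v × (∀ i → v (right i) ≡ r i)
  extension = extend 3 (entry (order s x y)) acyclic transitive r
    λ i j ij → All.lookup mono (toWitness (subst T (restricts i j) ij))

Heights : ∀ s m → Run s m → Set
Heights s m r = Σ (Fin (suc m) → Fin 3 → ℚ) λ h → Monotone ℚ._<_ s (h zero) × Realizes ℚ._<_ h (choices s m r)

HeightsFrom : ∀ s (x y : Fin 4) t m → RunFrom t m → Set
HeightsFrom s x y t m r = Σ (Fin (suc (suc m)) → Fin 3 → ℚ) λ h →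
  Monotone ℚ._<_ s (h zero) ×
  Dominates ℚ._<_ (adjacent h zero) zero x × Dominates ℚ._<_ (adjacent h zero) (suc zero) y ×
  Realizes ℚ._<_ (h ∘ suc) (choicesFrom t m r)

merge-heights : ∀ s m x y (r : RunFrom (next s x y) m) →
                HeightsFrom s x y (next s x y) m r → Heights s (suc m) (x , y , r)
merge-heights s m x y r (h , mono , dom₀ , dom₁ , real) = h , mono , realizes
  where
  realizes : Realizes ℚ._<_ h (choices s (suc m) (x , y , r))
  realizes zero    zero       = dom₀
  realizes zero    (suc zero) = dom₁
  realizes (suc j) i          = real j i

prepend-column : ∀ s x y t m (r : Run t m) → Transition (order s x y) (just t) → Heights t m r →
                 HeightsFrom s x y (just t) m r
prepend-column s x y t m r tr (h , mono , real) = h′ , proj₁ (proj₂ column)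
  , proj₁ (proj₂ (proj₂ column)) , proj₂ (proj₂ (proj₂ column)) , real
  where
  column = extend-column s x y t tr (h zero) mono
  h′ : Fin (suc (suc m)) → Fin 3 → ℚ
  h′ zero    = proj₁ column
  h′ (suc j) = h j

-- Starts with `rank` on the last column and adds columns on the left, each step needing only that
-- the column already built respects its state.
run-heights     : ∀ s m r → Heights s m r
run-heightsFrom : ∀ s x y t m (r : RunFrom t m) → Transition (order s x y) t → HeightsFrom s x y t m r
run-heights s zero    tt          = (λ _ → ℕ⇒ℚ ∘ rank s) , All.map ℕ⇒ℚ-mono-< (rank-monotone s) , λ ()
run-heights s (suc m) (x , y , r) =
  merge-heights s m x y r (run-heightsFrom s x y (next s x y) m r (transition s x y))
run-heightsFrom s x y (just t) m r tr = prepend-column s x y t m r tr (run-heights t m r)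

-- Counting runs

module ℕSum where
  open import Algebra.Properties.Semiring.Sum ℕₚ.+-*-semiring public

advance : (State → ℕ) → State → ℕ
advance c s = ℕSum.sum λ x → ℕSum.sum λ y → maybe c 0 (next s x y)

counts : ℕ → Vec ℕ 11
counts zero    = Vec.replicate _ 1
counts (suc m) = Vec.tabulate (advance (lookup (counts m)))

count : ℕ → State → ℕ
count m = lookup (counts m)

count-suc : ∀ m s → count (suc m) s ≡ advance (count m) s
count-suc m = Vecₚ.lookup∘tabulate (advance (count m))

-- The first four images of the all-ones vector under the transfer matrix. As numerals they let each
-- be checked by a single `advance` from the previous one, and `c-recurrent` by plain arithmetic.
c₁ c₂ c₃ c₄ : Vec ℕ 11
c₁ = 14 ∷ 10 ∷ 11 ∷ 10 ∷ 8 ∷ 11 ∷ 9 ∷ 10 ∷ 7 ∷ 10 ∷ 8 ∷ []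
c₂ = 150 ∷ 101 ∷ 112 ∷ 101 ∷ 77 ∷ 112 ∷ 88 ∷ 101 ∷ 66 ∷ 101 ∷ 77 ∷ []
c₃ = 1536 ∷ 1023 ∷ 1135 ∷ 1023 ∷ 772 ∷ 1135 ∷ 884 ∷ 1023 ∷ 660 ∷ 1023 ∷ 772 ∷ []
c₄ = 15594 ∷ 10364 ∷ 11499 ∷ 10364 ∷ 7805 ∷ 11499 ∷ 8940 ∷ 10364 ∷ 6670 ∷ 10364 ∷ 7805 ∷ []

counts₁ : counts 1 ≡ c₁
counts₁ = refl

counts₂ : counts 2 ≡ c₂
counts₂ = cong (Vec.tabulate ∘ advance ∘ lookup) counts₁

counts₃ : counts 3 ≡ c₃
counts₃ = cong (Vec.tabulate ∘ advance ∘ lookup) counts₂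

counts₄ : counts 4 ≡ c₄
counts₄ = cong (Vec.tabulate ∘ advance ∘ lookup) counts₃

-- e = 13d − 31c + 20b − 4a, arranged so that no subtraction occurs.
Recurrent : (a b c d e : ℕ) → Set
Recurrent a b c d e = e ℕ.+ 31 ℕ.* c ℕ.+ 4 ℕ.* a ≡ 13 ℕ.* d ℕ.+ 20 ℕ.* b

recurrent-resp : ∀ {a a′ b b′ c c′ d d′ e e′} → a ≡ a′ → b ≡ b′ → c ≡ c′ → d ≡ d′ → e ≡ e′ →
                 Recurrent a′ b′ c′ d′ e′ → Recurrent a b c d e
recurrent-resp refl refl refl refl refl rec = rec

sum-recurrent : ∀ {n} {a b c d e : Fin n → ℕ} →
  (∀ i → Recurrent (a i) (b i) (c i) (d i) (e i)) →
  Recurrent (ℕSum.sum a) (ℕSum.sum b) (ℕSum.sum c) (ℕSum.sum d) (ℕSum.sum e)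
sum-recurrent {a = a} {b} {c} {d} {e} rec = begin
  sum e ℕ.+ 31 ℕ.* sum c ℕ.+ 4 ℕ.* sum a
    ≡⟨ cong₂ (λ p q → sum e ℕ.+ p ℕ.+ q) (*-distribˡ-sum 31 c) (*-distribˡ-sum 4 a) ⟩
  sum e ℕ.+ sum (λ i → 31 ℕ.* c i) ℕ.+ sum (λ i → 4 ℕ.* a i)
    ≡⟨ cong (ℕ._+ _) (∑-distrib-+ e _) ⟨
  sum (λ i → e i ℕ.+ 31 ℕ.* c i) ℕ.+ sum (λ i → 4 ℕ.* a i)
    ≡⟨ ∑-distrib-+ _ (λ i → 4 ℕ.* a i) ⟨
  sum (λ i → e i ℕ.+ 31 ℕ.* c i ℕ.+ 4 ℕ.* a i)
    ≡⟨ sum-cong-≗ rec ⟩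
  sum (λ i → 13 ℕ.* d i ℕ.+ 20 ℕ.* b i)
    ≡⟨ ∑-distrib-+ (λ i → 13 ℕ.* d i) _ ⟩
  sum (λ i → 13 ℕ.* d i) ℕ.+ sum (λ i → 20 ℕ.* b i)
    ≡⟨ cong₂ ℕ._+_ (*-distribˡ-sum 13 d) (*-distribˡ-sum 20 b) ⟨
  13 ℕ.* sum d ℕ.+ 20 ℕ.* sum b ∎
  where
  open ≡.≡-Reasoning
  open ℕSum

advance-recurrent : ∀ {a b c d e} → (∀ s → Recurrent (a s) (b s) (c s) (d s) (e s)) →
                    ∀ s → Recurrent (advance a s) (advance b s) (advance c s) (advance d s) (advance e s)
advance-recurrent {a} {b} {c} {d} {e} rec s =
  sum-recurrent {a = sum₁ a} {sum₁ b} {sum₁ c} {sum₁ d} {sum₁ e} λ x →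
  sum-recurrent {a = term a x} {term b x} {term c x} {term d x} {term e x} λ y → go (next s x y)
  where
  term : (State → ℕ) → Fin 4 → Fin 4 → ℕ
  term f x y = maybe f 0 (next s x y)
  sum₁ : (State → ℕ) → Fin 4 → ℕ
  sum₁ f x = ℕSum.sum (term f x)
  go : ∀ t → Recurrent (maybe a 0 t) (maybe b 0 t) (maybe c 0 t) (maybe d 0 t) (maybe e 0 t)
  go nothing  = refl
  go (just t) = rec t

recurrent? : ∀ a b c d e → Dec (Recurrent a b c d e)
recurrent? a b c d e = e ℕ.+ 31 ℕ.* c ℕ.+ 4 ℕ.* a ℕ.≟ 13 ℕ.* d ℕ.+ 20 ℕ.* b

c-recurrent : ∀ s → Recurrent (lookup (counts 0) s) (lookup c₁ s) (lookup c₂ s) (lookup c₃ s) (lookup c₄ s)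
c-recurrent = from-yes (Finₚ.all? λ s →
  recurrent? (lookup (counts 0) s) (lookup c₁ s) (lookup c₂ s) (lookup c₃ s) (lookup c₄ s))

-- The relation is linear with constant coefficients, hence preserved by `advance`. Checking it
-- once, on the all-ones vector and its first four images, is enough for all `m`.
count-recurrent : ∀ m s → Recurrent (count m s) (count (1 ℕ.+ m) s) (count (2 ℕ.+ m) s)
                                    (count (3 ℕ.+ m) s) (count (4 ℕ.+ m) s)
count-recurrent zero    s = recurrent-resp {a = count 0 s} refl
  (cong at-s counts₁) (cong at-s counts₂) (cong at-s counts₃) (cong at-s counts₄) (c-recurrent s)
  where
  at-s : Vec ℕ 11 → ℕ
  at-s c = lookup c s
count-recurrent (suc m) s =
  recurrent-resp (count-suc m s) (count-suc (1 ℕ.+ m) s) (count-suc (2 ℕ.+ m) s)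
    (count-suc (3 ℕ.+ m) s) (count-suc (4 ℕ.+ m) s)
    (advance-recurrent {count m} {count (1 ℕ.+ m)} {count (2 ℕ.+ m)} {count (3 ℕ.+ m)} {count (4 ℕ.+ m)}
      (count-recurrent m) s)

Σ-Fin : ∀ {n} (f : Fin n → ℕ) → Σ (Fin n) (λ i → Fin (f i)) ↔ Fin (ℕSum.sum f)
Σ-Fin {zero}  f = mk↔ₛ′ (λ ()) (λ ()) (λ ()) (λ ())
Σ-Fin {suc n} f =
  ↔-trans split (↔-trans (↔-refl ⊎-↔ Σ-Fin (f ∘ suc)) (↔-sym Finₚ.+↔⊎))
  where
  split : Σ (Fin (suc n)) (λ i → Fin (f i)) ↔ (Fin (f zero) ⊎ Σ (Fin n) (λ i → Fin (f (suc i))))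
  split = mk↔ₛ′ (λ { (zero , k) → inj₁ k ; (suc i , k) → inj₂ (i , k) })
    [ zero ,_ , (λ (i , k) → suc i , k) ]
    (λ { (inj₁ k) → refl ; (inj₂ (i , k)) → refl })
    (λ { (zero , k) → refl ; (suc i , k) → refl })

run↔Fin     : ∀ s m → Run s m ↔ Fin (count m s)
runFrom↔Fin : ∀ t m → RunFrom t m ↔ Fin (maybe (count m) 0 t)
run↔Fin s zero    = subst (λ k → ⊤ ↔ Fin k) (sym (Vecₚ.lookup-replicate s 1))
  (mk↔ₛ′ (λ _ → zero) (λ _ → tt) (λ { zero → refl }) (λ _ → refl))
run↔Fin s (suc m) = subst (λ k → Run s (suc m) ↔ Fin k) (sym (count-suc m s))
  (↔-trans (Σ-Function.Σ-↔ ↔-refl (λ {x} →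
     ↔-trans (Σ-Function.Σ-↔ ↔-refl (λ {y} → runFrom↔Fin (next s x y) m)) (Σ-Fin _)))
   (Σ-Fin _))
runFrom↔Fin nothing  m = mk↔ₛ′ (λ ()) (λ ()) (λ ()) (λ ())
runFrom↔Fin (just t) m = run↔Fin t m

open import Defs

-- The power series

p-coeffs q-coeffs : List ℤ
p-coeffs = + 0 ∷ + 1 ∷ + 1 ∷ - (+ 1) ∷ []
q-coeffs = + 1 ∷ - (+ 13) ∷ + 31 ∷ - (+ 20) ∷ + 4 ∷ []

0⊛ : ∀ g n → (polynomial [] ⊛ g) n ≡ + 0
0⊛ g zero    = refl
0⊛ g (suc n) = trans (ℤₚ.+-identityˡ _) (0⊛ g n)

[a]⊛ : ∀ a g n → (polynomial (a ∷ []) ⊛ g) n ≡ a ℤ.* g n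
[a]⊛ a g zero    = ℤₚ.+-identityʳ _
[a]⊛ a g (suc n) = trans (cong (λ t → a ℤ.* g (suc n) ℤ.+ t) (0⊛ g n)) (ℤₚ.+-identityʳ _)

-- 1/q shifted by three places, so that its recurrence holds from the start.
ρ : ℕ → ℤ
ρ 0 = + 0
ρ 1 = + 0
ρ 2 = + 0
ρ 3 = + 1
ρ (suc n₃@(suc n₂@(suc n₁@(suc n)))) =
  + 13 ℤ.* ρ n₃ ℤ.- + 31 ℤ.* ρ n₂ ℤ.+ + 20 ℤ.* ρ n₁ ℤ.- + 4 ℤ.* ρ n

q⁻¹ : PowerSeries
q⁻¹ n = ρ (3 ℕ.+ n)

-- The first four summands appear by computation; the remaining tail is the convolution of the
-- constant polynomial 4 with `g`, which `[a]⊛` collapses to its first term.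
q⊛ : ∀ g n → (polynomial q-coeffs ⊛ g) (4 ℕ.+ n) ≡
     + 1 ℤ.* g (4 ℕ.+ n) ℤ.+ (- (+ 13) ℤ.* g (3 ℕ.+ n) ℤ.+ (+ 31 ℤ.* g (2 ℕ.+ n) ℤ.+
       (- (+ 20) ℤ.* g (1 ℕ.+ n) ℤ.+ + 4 ℤ.* g n)))
q⊛ g n = cong (λ t → + 1 ℤ.* g (4 ℕ.+ n) ℤ.+ (- (+ 13) ℤ.* g (3 ℕ.+ n) ℤ.+ (+ 31 ℤ.* g (2 ℕ.+ n) ℤ.+
  (- (+ 20) ℤ.* g (1 ℕ.+ n) ℤ.+ t)))) ([a]⊛ (+ 4) g n)

p⊛ : ∀ g n → (polynomial p-coeffs ⊛ g) (3 ℕ.+ n) ≡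
     + 0 ℤ.* g (3 ℕ.+ n) ℤ.+ (+ 1 ℤ.* g (2 ℕ.+ n) ℤ.+ (+ 1 ℤ.* g (1 ℕ.+ n) ℤ.+ - (+ 1) ℤ.* g n))
p⊛ g n = cong (λ t → + 0 ℤ.* g (3 ℕ.+ n) ℤ.+ (+ 1 ℤ.* g (2 ℕ.+ n) ℤ.+ (+ 1 ℤ.* g (1 ℕ.+ n) ℤ.+ t)))
  ([a]⊛ (- (+ 1)) g n)

annihilates : ∀ a b c d →
  + 1 ℤ.* (+ 13 ℤ.* d ℤ.- + 31 ℤ.* c ℤ.+ + 20 ℤ.* b ℤ.- + 4 ℤ.* a) ℤ.+
  (- (+ 13) ℤ.* d ℤ.+ (+ 31 ℤ.* c ℤ.+ (- (+ 20) ℤ.* b ℤ.+ + 4 ℤ.* a))) ≡ + 0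
annihilates = solve 4 (λ a b c d →
  con (+ 1) :* (con (+ 13) :* d :- con (+ 31) :* c :+ con (+ 20) :* b :- con (+ 4) :* a) :+
  (con (- (+ 13)) :* d :+ (con (+ 31) :* c :+ (con (- (+ 20)) :* b :+ con (+ 4) :* a))) := con (+ 0)) refl
  where open ℤSolver.+-*-Solver

q⊛q⁻¹ : polynomial q-coeffs ⊛ q⁻¹ ≐ polynomial (+ 1 ∷ [])
q⊛q⁻¹ 0 = refl
q⊛q⁻¹ 1 = refl
q⊛q⁻¹ 2 = refl
q⊛q⁻¹ 3 = refl
q⊛q⁻¹ (suc (suc (suc (suc n)))) =
  trans (q⊛ q⁻¹ n) (annihilates (ρ (3 ℕ.+ n)) (ρ (4 ℕ.+ n)) (ρ (5 ℕ.+ n)) (ρ (6 ℕ.+ n)))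

p⊛-simplified : ∀ z b c d → + 0 ℤ.* z ℤ.+ (+ 1 ℤ.* d ℤ.+ (+ 1 ℤ.* c ℤ.+ - (+ 1) ℤ.* b)) ≡ d ℤ.+ c ℤ.- b
p⊛-simplified = solve 4 (λ z b c d →
  con (+ 0) :* z :+ (con (+ 1) :* d :+ (con (+ 1) :* c :+ con (- (+ 1)) :* b)) := d :+ c :- b) refl
  where open ℤSolver.+-*-Solver

p⊛q⁻¹ : ∀ n → (polynomial p-coeffs ⊛ q⁻¹) n ≡ ρ (2 ℕ.+ n) ℤ.+ ρ (1 ℕ.+ n) ℤ.- ρ n
p⊛q⁻¹ 0 = refl
p⊛q⁻¹ 1 = refl
p⊛q⁻¹ 2 = refl
p⊛q⁻¹ (suc (suc (suc n))) =
  trans (p⊛ q⁻¹ n) (p⊛-simplified (ρ (6 ℕ.+ n)) (ρ (3 ℕ.+ n)) (ρ (4 ℕ.+ n)) (ρ (5 ℕ.+ n)))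

recur : ℤ → ℤ → ℤ → ℤ → ℤ
recur a b c d = + 13 ℤ.* d ℤ.- + 31 ℤ.* c ℤ.+ + 20 ℤ.* b ℤ.- + 4 ℤ.* a

recur-cong : ∀ {a a′ b b′ c c′ d d′} → a ≡ a′ → b ≡ b′ → c ≡ c′ → d ≡ d′ → recur a b c d ≡ recur a′ b′ c′ d′
recur-cong refl refl refl refl = refl

Satisfies : PowerSeries → Set
Satisfies f = ∀ n → f (4 ℕ.+ n) ≡ recur (f n) (f (1 ℕ.+ n)) (f (2 ℕ.+ n)) (f (3 ℕ.+ n))

satisfies-unique : ∀ f g → Satisfies f → Satisfies g →
                   f 0 ≡ g 0 → f 1 ≡ g 1 → f 2 ≡ g 2 → f 3 ≡ g 3 → f ≐ g
satisfies-unique f g Sf Sg e₀ e₁ e₂ e₃ n = proj₁ (go n)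
  where
  go : ∀ n → f n ≡ g n × f (1 ℕ.+ n) ≡ g (1 ℕ.+ n) × f (2 ℕ.+ n) ≡ g (2 ℕ.+ n) × f (3 ℕ.+ n) ≡ g (3 ℕ.+ n)
  go zero = e₀ , e₁ , e₂ , e₃
  go (suc n) with go n
  ... | a , b , c , d = b , c , d , trans (Sf n) (trans (recur-cong a b c d) (sym (Sg n)))

satisfies-resp : ∀ f g → f ≐ g → Satisfies g → Satisfies f
satisfies-resp f g f≐g Sg n = trans (f≐g (4 ℕ.+ n)) (trans (Sg n)
  (sym (recur-cong (f≐g n) (f≐g (1 ℕ.+ n)) (f≐g (2 ℕ.+ n)) (f≐g (3 ℕ.+ n)))))

combination-satisfies : ∀ f → Satisfies f → Satisfies (λ n → f (2 ℕ.+ n) ℤ.+ f (1 ℕ.+ n) ℤ.- f n)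
combination-satisfies f Sf n = trans
  (cong₂ ℤ._-_ (cong₂ ℤ._+_ (Sf (2 ℕ.+ n)) (Sf (1 ℕ.+ n))) (Sf n))
  (linear (f n) (f (1 ℕ.+ n)) (f (2 ℕ.+ n)) (f (3 ℕ.+ n)) (f (4 ℕ.+ n)) (f (5 ℕ.+ n)))
  where
  open ℤSolver.+-*-Solver
  linear : ∀ a b c d e f → recur c d e f ℤ.+ recur b c d e ℤ.- recur a b c d ≡
           recur (c ℤ.+ b ℤ.- a) (d ℤ.+ c ℤ.- b) (e ℤ.+ d ℤ.- c) (f ℤ.+ e ℤ.- d)
  linear = solve 6 (λ a b c d e f →
    let recur = λ w x y z → con (+ 13) :* z :- con (+ 31) :* y :+ con (+ 20) :* x :- con (+ 4) :* w in
    recur c d e f :+ recur b c d e :- recur a b c d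
      := recur (c :+ b :- a) (d :+ c :- b) (e :+ d :- c) (f :+ e :- d)) refl

p⊛q⁻¹-satisfies : Satisfies (polynomial p-coeffs ⊛ q⁻¹)
p⊛q⁻¹-satisfies = satisfies-resp (polynomial p-coeffs ⊛ q⁻¹) (λ n → ρ (2 ℕ.+ n) ℤ.+ ρ (1 ℕ.+ n) ℤ.- ρ n) p⊛q⁻¹
  (combination-satisfies ρ λ n → refl)

-- Among `n` columns there are `n ∸ 1` adjacent pairs, and the first column starts with the empty
-- order, state `zero`.
vertexCount : ℕ → ℕ
vertexCount n = count (n ∸ 1) zero

vertexCount₂ : vertexCount 2 ≡ 14
vertexCount₂ = cong (λ c → lookup c zero) counts₁

vertexCount₃ : vertexCount 3 ≡ 150
vertexCount₃ = cong (λ c → lookup c zero) counts₂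

vertexCount₄ : vertexCount 4 ≡ 1536
vertexCount₄ = cong (λ c → lookup c zero) counts₃

recurrent⇒recur : ∀ {a b c d e} → Recurrent a b c d e → + e ≡ recur (+ a) (+ b) (+ c) (+ d)
recurrent⇒recur {a} {b} {c} {d} {e} rec = begin
  + e
    ≡⟨ isolate (+ e) (+ c) (+ a) ⟩
  (+ e ℤ.+ + 31 ℤ.* + c ℤ.+ + 4 ℤ.* + a) ℤ.- + 31 ℤ.* + c ℤ.- + 4 ℤ.* + a
    ≡⟨ cong (λ t → t ℤ.- + 31 ℤ.* + c ℤ.- + 4 ℤ.* + a) cast ⟩
  (+ 13 ℤ.* + d ℤ.+ + 20 ℤ.* + b) ℤ.- + 31 ℤ.* + c ℤ.- + 4 ℤ.* + a
    ≡⟨ rearrange (+ a) (+ b) (+ c) (+ d) ⟩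
  recur (+ a) (+ b) (+ c) (+ d) ∎
  where
  open ℤSolver.+-*-Solver
  open ≡.≡-Reasoning
  isolate : ∀ e c a → e ≡ (e ℤ.+ + 31 ℤ.* c ℤ.+ + 4 ℤ.* a) ℤ.- + 31 ℤ.* c ℤ.- + 4 ℤ.* a
  isolate = solve 3 (λ e c a →
    e := (e :+ con (+ 31) :* c :+ con (+ 4) :* a) :- con (+ 31) :* c :- con (+ 4) :* a) refl
  rearrange : ∀ a b c d → (+ 13 ℤ.* d ℤ.+ + 20 ℤ.* b) ℤ.- + 31 ℤ.* c ℤ.- + 4 ℤ.* a ≡ recur a b c d
  rearrange = solve 4 (λ a b c d →
    (con (+ 13) :* d :+ con (+ 20) :* b) :- con (+ 31) :* c :- con (+ 4) :* a :=
    con (+ 13) :* d :- con (+ 31) :* c :+ con (+ 20) :* b :- con (+ 4) :* a) refl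
  cast : + e ℤ.+ + 31 ℤ.* + c ℤ.+ + 4 ℤ.* + a ≡ + 13 ℤ.* + d ℤ.+ + 20 ℤ.* + b
  cast = trans (cong₂ (λ x y → + e ℤ.+ x ℤ.+ y) (sym (ℤₚ.pos-* 31 c)) (sym (ℤₚ.pos-* 4 a)))
    (trans (cong +_ rec) (cong₂ ℤ._+_ (ℤₚ.pos-* 13 d) (ℤₚ.pos-* 20 b)))

-- The conventional coefficient 1 of x agrees with `count 0 zero`, the one empty run, so the
-- recurrence for runs already holds from index 1.
x+∑vertexCount-suc : ∀ n → (x+∑ vertexCount) (suc n) ≡ + count n zero
x+∑vertexCount-suc zero    = refl
x+∑vertexCount-suc (suc n) = refl

vertexCount-satisfies : Satisfies (x+∑ vertexCount)
-- The constant coefficient 0 is not a count of runs, so this instance is numerical: 1536 = 13 · 150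
-- - 31 · 14 + 20 · 1 - 4 · 0.
vertexCount-satisfies zero    = trans (cong +_ vertexCount₄)
  (sym (recur-cong {+ 0} {+ 0} {+ 1} {+ 1} refl refl (cong +_ vertexCount₂) (cong +_ vertexCount₃)))
vertexCount-satisfies (suc n) = trans
  (recurrent⇒recur {count n zero} {count (1 ℕ.+ n) zero} {count (2 ℕ.+ n) zero} {count (3 ℕ.+ n) zero}
    {count (4 ℕ.+ n) zero} (count-recurrent n zero))
  (cong (λ t → recur t (+ count (1 ℕ.+ n) zero) (+ count (2 ℕ.+ n) zero) (+ count (3 ℕ.+ n) zero))
    (sym (x+∑vertexCount-suc n)))

vertexCount-expansion : (x+∑ vertexCount) ≐ polynomial p-coeffs ⊛ q⁻¹
vertexCount-expansion = satisfies-unique (x+∑ vertexCount) (polynomial p-coeffs ⊛ q⁻¹)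
  vertexCount-satisfies p⊛q⁻¹-satisfies refl refl (cong +_ vertexCount₂) (cong +_ vertexCount₃)

-- The ordered semiring of real numbers

eventually : ∀ {P Q : Pred ℕ 0ℓ} → (∀ n → P n → Q n) → Eventually P → Eventually Q
eventually f (N , h) = N , λ n N≤n → f n (h n N≤n)

eventually₂ : ∀ {P Q R : Pred ℕ 0ℓ} → (∀ n → P n → Q n → R n) → Eventually P → Eventually Q → Eventually R
eventually₂ f (M , h) (N , k) = M ℕ.⊔ N , λ n ≤n →
  f n (h n (ℕₚ.≤-trans (ℕₚ.m≤m⊔n M N) ≤n)) (k n (ℕₚ.≤-trans (ℕₚ.m≤n⊔m M N) ≤n))

½-pos : ∀ {ε} → 0ℚ ℚ.< ε → 0ℚ ℚ.< ½ ℚ.* ε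
½-pos {ε} ε>0 = subst (ℚ._< ½ ℚ.* ε) (ℚₚ.*-zeroʳ ½) (ℚₚ.*-monoʳ-<-pos ½ ε>0)

½+½ : ∀ ε → ½ ℚ.* ε ℚ.+ ½ ℚ.* ε ≡ ε
½+½ ε = trans (sym (ℚₚ.*-distribʳ-+ ε ½ ½)) (ℚₚ.*-identityˡ ε)

quotient : ∀ B ε → 0ℚ ℚ.< B → 0ℚ ℚ.< ε → ∃ λ δ → 0ℚ ℚ.< δ × B ℚ.* δ ≡ ε
quotient B ε B>0 ε>0 = ℚ.1/ B ℚ.* ε
  , subst (ℚ._< ℚ.1/ B ℚ.* ε) (ℚₚ.*-zeroʳ (ℚ.1/ B)) (ℚₚ.*-monoʳ-<-pos (ℚ.1/ B) ε>0)
  , trans (sym (ℚₚ.*-assoc B (ℚ.1/ B) ε)) (trans (cong (ℚ._* ε) (ℚₚ.*-inverseʳ B)) (ℚₚ.*-identityˡ ε))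
  where
  instance
    B-pos : ℚ.Positive B
    B-pos = ℚ.positive B>0
    B-nonZero : ℚ.NonZero B
    B-nonZero = ℚₚ.pos⇒nonZero B
    B⁻¹-pos : ℚ.Positive (ℚ.1/ B)
    B⁻¹-pos = ℚₚ.1/pos⇒pos B

open ℚSolver.+-*-Solver using (solve; con; _:+_; _:*_; _:-_; :-_; _:=_)

<+⇒-< : ∀ {p q r} → p ℚ.< q ℚ.+ r → p ℚ.- q ℚ.< r
<+⇒-< {p} {q} {r} h = subst (p ℚ.- q ℚ.<_) (solve 2 (λ q r → q :+ r :- q := r) refl q r) (ℚₚ.+-monoˡ-< (ℚ.- q) h)

-<⇒<+ : ∀ {p q r} → p ℚ.- q ℚ.< r → p ℚ.< q ℚ.+ r
-<⇒<+ {p} {q} {r} h =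
  subst (ℚ._< q ℚ.+ r) (solve 2 (λ p q → q :+ (p :- q) := p) refl p q) (ℚₚ.+-monoʳ-< q h)

∣∣<⇒< : ∀ {p q} → ℚ.∣ p ∣ ℚ.< q → p ℚ.< q
∣∣<⇒< {p} h = ℚₚ.≤-<-trans (p≤∣p∣ p) h
  where
  p≤∣p∣ : ∀ p → p ℚ.≤ ℚ.∣ p ∣
  p≤∣p∣ p with ℚₚ.≤-total 0ℚ p
  ... | inj₁ 0≤p = ℚₚ.≤-reflexive (sym (ℚₚ.0≤p⇒∣p∣≡p 0≤p))
  ... | inj₂ p≤0 = ℚₚ.≤-trans p≤0 (ℚₚ.0≤∣p∣ p)

<⇒∣∣< : ∀ {p q} → p ℚ.< q → ℚ.- p ℚ.< q → ℚ.∣ p ∣ ℚ.< q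
<⇒∣∣< {p} {q} p<q -p<q with ℚₚ.∣p∣≡p∨∣p∣≡-p p
... | inj₁ eq = subst (ℚ._< q) (sym eq) p<q
... | inj₂ eq = subst (ℚ._< q) (sym eq) -p<q

bounded : ∀ x → ∃ λ B → 0ℚ ℚ.< B × Eventually (λ n → ℚ.∣ seq x n ∣ ℚ.< B)
bounded x with cauchy x 1ℚ (ℚₚ.positive⁻¹ 1ℚ)
... | N , h = 1ℚ ℚ.+ ℚ.∣ seq x N ∣
  , ℚₚ.+-mono-<-≤ (ℚₚ.positive⁻¹ 1ℚ) (ℚₚ.0≤∣p∣ (seq x N))
  , N , λ n N≤n → ℚₚ.≤-<-trans
      (subst (λ t → ℚ.∣ t ∣ ℚ.≤ ℚ.∣ seq x n ℚ.- seq x N ∣ ℚ.+ ℚ.∣ seq x N ∣)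
        (solve 2 (λ a b → (a :- b) :+ b := a) refl (seq x n) (seq x N))
        (ℚₚ.∣p+q∣≤∣p∣+∣q∣ (seq x n ℚ.- seq x N) (seq x N)))
      (ℚₚ.+-monoˡ-< ℚ.∣ seq x N ∣ (h n N N≤n ℕₚ.≤-refl))

pointwise : ∀ {x y} → (∀ n → seq x n ≡ seq y n) → x ≈ y
pointwise {x} {y} eq ε ε>0 = 0 , λ n _ →
  subst (λ t → ℚ.∣ seq x n ℚ.- t ∣ ℚ.< ε) (eq n)
    (subst (ℚ._< ε) (sym (cong ℚ.∣_∣ (ℚₚ.+-inverseʳ (seq x n)))) ε>0)

≤-reflexive : ∀ {x y} → x ≈ y → x ≤ y
≤-reflexive {x} {y} x≈y ε ε>0 = eventually (λ n h → -<⇒<+ {seq x n} {seq y n} (∣∣<⇒< h)) (x≈y ε ε>0)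

≤-antisym : ∀ {x y} → x ≤ y → y ≤ x → x ≈ y
≤-antisym {x} {y} x≤y y≤x ε ε>0 = eventually₂
  (λ n h k → <⇒∣∣< (<+⇒-< {seq x n} {seq y n} h)
    (subst (ℚ._< ε) (solve 2 (λ a b → b :- a := :- (a :- b)) refl (seq x n) (seq y n)) (<+⇒-< {seq y n} {seq x n} k)))
  (x≤y ε ε>0) (y≤x ε ε>0)

≤-refl : ∀ {x} → x ≤ x
≤-refl {x} = ≤-reflexive {x} {x} (≈-refl {x})

≤-trans : ∀ {x y z} → x ≤ y → y ≤ z → x ≤ z
≤-trans {x} {y} {z} x≤y y≤z ε ε>0 = eventually₂
  (λ n h k → subst (seq x n ℚ.<_)
    (trans (ℚₚ.+-assoc (seq z n) _ _) (cong (seq z n ℚ.+_) (½+½ ε)))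
    (ℚₚ.<-trans h (ℚₚ.+-monoˡ-< (½ ℚ.* ε) k)))
  (x≤y _ (½-pos ε>0)) (y≤z _ (½-pos ε>0))

+-mono-≤ : ∀ {x y u v} → x ≤ y → u ≤ v → x + u ≤ y + v
+-mono-≤ {x} {y} {u} {v} x≤y u≤v ε ε>0 = eventually₂
  (λ n h k → subst (seq x n ℚ.+ seq u n ℚ.<_)
    (trans (solve 3 (λ a b h → (a :+ h) :+ (b :+ h) := (a :+ b) :+ (h :+ h)) refl (seq y n) (seq v n) (½ ℚ.* ε))
           (cong (seq y n ℚ.+ seq v n ℚ.+_) (½+½ ε)))
    (ℚₚ.+-mono-< h k))
  (x≤y _ (½-pos ε>0)) (u≤v _ (½-pos ε>0))

+-cancelˡ-≤ : ∀ {x y} z → z + x ≤ z + y → x ≤ y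
+-cancelˡ-≤ {x} {y} z h ε ε>0 = eventually
  (λ n k → subst₂ ℚ._<_
    (solve 2 (λ z x → :- z :+ (z :+ x) := x) refl (seq z n) (seq x n))
    (solve 3 (λ z y e → :- z :+ (z :+ y :+ e) := y :+ e) refl (seq z n) (seq y n) ε)
    (ℚₚ.+-monoʳ-< (ℚ.- seq z n) k))
  (h ε ε>0)

+-cong : ∀ {x y u v} → x ≈ y → u ≈ v → x + u ≈ y + v
+-cong {x} {y} {u} {v} x≈y u≈v = ≤-antisym {x + u} {y + v}
  (+-mono-≤ {x} {y} {u} {v} (≤-reflexive {x} {y} x≈y) (≤-reflexive {u} {v} u≈v))
  (+-mono-≤ {y} {x} {v} {u} (≤-reflexive {y} {x} (≈-sym {x} {y} x≈y)) (≤-reflexive {v} {u} (≈-sym {u} {v} u≈v)))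

-- The hypothesis on `w` only excludes values up to `- δ`, so `w` itself may be negative and the
-- inequality is multiplied by `w + δ` instead. The error is δ (w - x + y + δ), and the bracket is
-- below A + B + C + 1.
*-slack : ∀ w x y δ {δ₀ A B C ε} → 0ℚ ℚ.< δ → δ ℚ.≤ δ₀ → δ ℚ.≤ 1ℚ →
          ℚ.NonNegative (A ℚ.+ B ℚ.+ C ℚ.+ 1ℚ) → (A ℚ.+ B ℚ.+ C ℚ.+ 1ℚ) ℚ.* δ₀ ≡ ε →
          ℚ.∣ w ∣ ℚ.< A → ℚ.∣ x ∣ ℚ.< B → ℚ.∣ y ∣ ℚ.< C →
          0ℚ ℚ.< w ℚ.+ δ → x ℚ.< y ℚ.+ δ → w ℚ.* x ℚ.< w ℚ.* y ℚ.+ ε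
*-slack w x y δ {δ₀} {A} {B} {C} {ε} δ>0 δ≤δ₀ δ≤1 D≥0 Dδ₀≡ε w< x< y< 0<w+δ x<y+δ = begin-strict
  w ℚ.* x
    ≡⟨ solve 3 (λ w x d → w :* x := (w :+ d) :* x :- d :* x) refl w x δ ⟩
  (w ℚ.+ δ) ℚ.* x ℚ.- δ ℚ.* x
    <⟨ ℚₚ.+-monoˡ-< (ℚ.- (δ ℚ.* x)) (ℚₚ.*-monoʳ-<-pos (w ℚ.+ δ) {{ℚ.positive 0<w+δ}} x<y+δ) ⟩
  (w ℚ.+ δ) ℚ.* (y ℚ.+ δ) ℚ.- δ ℚ.* x
    ≡⟨ solve 4 (λ w x y d → (w :+ d) :* (y :+ d) :- d :* x := w :* y :+ d :* (w :+ (:- x) :+ y :+ d)) refl w x y δ ⟩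
  w ℚ.* y ℚ.+ δ ℚ.* (w ℚ.+ ℚ.- x ℚ.+ y ℚ.+ δ)
    <⟨ ℚₚ.+-monoʳ-< (w ℚ.* y) (ℚₚ.*-monoʳ-<-pos δ {{ℚ.positive δ>0}}
         (ℚₚ.+-mono-<-≤ (ℚₚ.+-mono-< (ℚₚ.+-mono-< (∣∣<⇒< {w} w<) -x<B) (∣∣<⇒< {y} y<)) δ≤1)) ⟩
  w ℚ.* y ℚ.+ δ ℚ.* D
    ≤⟨ ℚₚ.+-monoʳ-≤ (w ℚ.* y) (ℚₚ.*-monoʳ-≤-nonNeg D {{D≥0}} δ≤δ₀) ⟩
  w ℚ.* y ℚ.+ δ₀ ℚ.* D
    ≡⟨ cong (w ℚ.* y ℚ.+_) (trans (ℚₚ.*-comm δ₀ D) Dδ₀≡ε) ⟩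
  w ℚ.* y ℚ.+ ε ∎
  where
  open ℚₚ.≤-Reasoning
  D = A ℚ.+ B ℚ.+ C ℚ.+ 1ℚ
  -x<B : ℚ.- x ℚ.< B
  -x<B = ∣∣<⇒< {ℚ.- x} (subst (ℚ._< B) (sym (ℚₚ.∣-p∣≡∣p∣ x)) x<)

*-monoˡ-≤ : ∀ {x y} w → 0ℝ ≤ w → x ≤ y → w * x ≤ w * y
*-monoˡ-≤ {x} {y} w 0≤w x≤y ε ε>0 = slack (bounded w) (bounded x) (bounded y)
  where
  Bounded : ℝ → Set
  Bounded x = ∃ λ B → 0ℚ ℚ.< B × Eventually (λ n → ℚ.∣ seq x n ∣ ℚ.< B)
  slack : Bounded w → Bounded x → Bounded y →
          Eventually λ n → seq w n ℚ.* seq x n ℚ.< seq w n ℚ.* seq y n ℚ.+ ε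
  slack (A , A>0 , w<A) (B , B>0 , x<B) (C , C>0 , y<C) = with-δ (quotient D ε D>0 ε>0)
    where
    D = A ℚ.+ B ℚ.+ C ℚ.+ 1ℚ
    D>0 : 0ℚ ℚ.< D
    D>0 = ℚₚ.+-mono-< (ℚₚ.+-mono-< (ℚₚ.+-mono-< A>0 B>0) C>0) (ℚₚ.positive⁻¹ 1ℚ)
    with-δ : (∃ λ δ₀ → 0ℚ ℚ.< δ₀ × D ℚ.* δ₀ ≡ ε) →
             Eventually λ n → seq w n ℚ.* seq x n ℚ.< seq w n ℚ.* seq y n ℚ.+ ε
    with-δ (δ₀ , δ₀>0 , Dδ₀≡ε) = eventually₂
      (λ n (w< , x<) (y< , 0<w+δ , x<y+δ) →
        *-slack (seq w n) (seq x n) (seq y n) δ δ>0 (ℚₚ.p⊓q≤p δ₀ 1ℚ) (ℚₚ.p⊓q≤q δ₀ 1ℚ)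
          (ℚ.nonNegative (ℚₚ.<⇒≤ D>0)) Dδ₀≡ε w< x< y< 0<w+δ x<y+δ)
      (eventually₂ (λ _ → _,_) w<A x<B)
      (eventually₂ (λ _ → _,_) y<C (eventually₂ (λ _ → _,_) (0≤w δ δ>0) (x≤y δ δ>0)))
      where
      -- The cap at 1 accounts for the summand `1ℚ` in `D`, which bounds the δ inside the error
      -- bracket.
      δ = δ₀ ℚ.⊓ 1ℚ
      δ>0 : 0ℚ ℚ.< δ
      δ>0 = ⊓-glb-< δ₀>0 (ℚₚ.positive⁻¹ 1ℚ)

-- Eventually `w` exceeds ½ q, so allowing the products the slack ½ q ε costs less than w ε, and
-- each term can be divided by the now positive `w`.
*-cancelˡ-≤ : ∀ {x y} w q → 0ℚ ℚ.< q → fromℚ q ≤ w → w * x ≤ w * y → x ≤ y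
*-cancelˡ-≤ {x} {y} w q q>0 q≤w wx≤wy ε ε>0 = eventually₂
  (λ n q<w+½q wx<wy+½qε →
    let w>½q : ½ ℚ.* q ℚ.< seq w n
        w>½q = subst₂ ℚ._<_
          (trans (cong (ℚ._- ½ ℚ.* q) (sym (½+½ q))) (solve 1 (λ h → h :+ h :- h := h) refl (½ ℚ.* q)))
          (solve 2 (λ w h → w :+ h :- h := w) refl (seq w n) (½ ℚ.* q))
          (ℚₚ.+-monoˡ-< (ℚ.- (½ ℚ.* q)) q<w+½q)
        wₙ-pos = ℚ.positive (ℚₚ.<-trans (½-pos q>0) w>½q)
    in ℚₚ.*-cancelˡ-<-nonNeg (seq w n) {{ℚₚ.pos⇒nonNeg (seq w n) {{wₙ-pos}}}} (begin-strict
      seq w n ℚ.* seq x n                        <⟨ wx<wy+½qε ⟩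
      seq w n ℚ.* seq y n ℚ.+ ½ ℚ.* q ℚ.* ε      <⟨ ℚₚ.+-monoʳ-< (seq w n ℚ.* seq y n) (ℚₚ.*-monoˡ-<-pos ε {{ℚ.positive ε>0}} w>½q) ⟩
      seq w n ℚ.* seq y n ℚ.+ seq w n ℚ.* ε      ≡⟨ ℚₚ.*-distribˡ-+ (seq w n) (seq y n) ε ⟨
      seq w n ℚ.* (seq y n ℚ.+ ε)                ∎))
  (q≤w (½ ℚ.* q) (½-pos q>0))
  (wx≤wy (½ ℚ.* q ℚ.* ε) (subst (ℚ._< ½ ℚ.* q ℚ.* ε) (ℚₚ.*-zeroˡ ε) (ℚₚ.*-monoˡ-<-pos ε {{ℚ.positive ε>0}} (½-pos q>0))))
  where open ℚₚ.≤-Reasoning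

*-comm : ∀ x y → x * y ≈ y * x
*-comm x y = pointwise {x * y} {y * x} λ n → ℚₚ.*-comm (seq x n) (seq y n)

*-close : ∀ w x y {B δ ε} → 0ℚ ℚ.< B → B ℚ.* δ ≡ ε → ℚ.∣ w ∣ ℚ.< B → ℚ.∣ x ℚ.- y ∣ ℚ.< δ →
          ℚ.∣ w ℚ.* x ℚ.- w ℚ.* y ∣ ℚ.< ε
*-close w x y {B} {δ} {ε} B>0 Bδ≡ε w<B d<δ = begin-strict
  ℚ.∣ w ℚ.* x ℚ.- w ℚ.* y ∣      ≡⟨ cong ℚ.∣_∣ (solve 3 (λ w x y → w :* x :- w :* y := w :* (x :- y)) refl w x y) ⟩
  ℚ.∣ w ℚ.* (x ℚ.- y) ∣          ≡⟨ ℚₚ.∣p*q∣≡∣p∣*∣q∣ w (x ℚ.- y) ⟩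
  ℚ.∣ w ∣ ℚ.* ℚ.∣ x ℚ.- y ∣      ≤⟨ ℚₚ.*-monoʳ-≤-nonNeg ℚ.∣ x ℚ.- y ∣ {{ℚₚ.∣-∣-nonNeg (x ℚ.- y)}} (ℚₚ.<⇒≤ w<B) ⟩
  B ℚ.* ℚ.∣ x ℚ.- y ∣            <⟨ ℚₚ.*-monoʳ-<-pos B {{ℚ.positive B>0}} d<δ ⟩
  B ℚ.* δ                        ≡⟨ Bδ≡ε ⟩
  ε                              ∎
  where open ℚₚ.≤-Reasoning

*-congˡ : ∀ w {x y} → x ≈ y → w * x ≈ w * y
*-congˡ w {x} {y} x≈y ε ε>0 =
  eventually₂ (λ n → *-close (seq w n) (seq x n) (seq y n) B>0 Bδ≡ε) w<B (x≈y δ δ>0)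
  where
  B = proj₁ (bounded w)
  B>0 = proj₁ (proj₂ (bounded w))
  w<B = proj₂ (proj₂ (bounded w))
  δ = proj₁ (quotient B ε B>0 ε>0)
  δ>0 = proj₁ (proj₂ (quotient B ε B>0 ε>0))
  Bδ≡ε = proj₂ (proj₂ (quotient B ε B>0 ε>0))

*-cong : ∀ {x y u v} → x ≈ y → u ≈ v → x * u ≈ y * v
*-cong {x} {y} {u} {v} x≈y u≈v =
  ≈-trans {x * u} {x * v} {y * v} (*-congˡ x {u} {v} u≈v)
    (≈-trans {x * v} {v * x} {y * v} (*-comm x v)
      (≈-trans {v * x} {v * y} {y * v} (*-congˡ v {x} {y} x≈y) (*-comm v y)))

ℝ-commutativeSemiring : CommutativeSemiring 0ℓ 0ℓ
ℝ-commutativeSemiring = record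
  { Carrier = ℝ ; _≈_ = _≈_ ; _+_ = _+_ ; _*_ = _*_ ; 0# = 0ℝ ; 1# = 1ℝ
  ; isCommutativeSemiring = record
    { isSemiring = record
      { isSemiringWithoutAnnihilatingZero = record
        { +-isCommutativeMonoid = record
          { isMonoid = record
            { isSemigroup = record
              { isMagma = record
                { isEquivalence = record
                  { refl  = λ {x} → ≈-refl {x}
                  ; sym   = λ {x} {y} → ≈-sym {x} {y}
                  ; trans = λ {x} {y} {z} → ≈-trans {x} {y} {z} }
                ; ∙-cong = λ {x} {y} {u} {v} → +-cong {x} {y} {u} {v} }
              ; assoc = λ x y z → pointwise {x + y + z} {x + (y + z)} λ n → ℚₚ.+-assoc (seq x n) (seq y n) (seq z n) }
            ; identity = (λ x → pointwise {0ℝ + x} {x} λ n → ℚₚ.+-identityˡ (seq x n))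
                       , (λ x → pointwise {x + 0ℝ} {x} λ n → ℚₚ.+-identityʳ (seq x n)) }
          ; comm = λ x y → pointwise {x + y} {y + x} λ n → ℚₚ.+-comm (seq x n) (seq y n) }
        ; *-cong = λ {x} {y} {u} {v} → *-cong {x} {y} {u} {v}
        ; *-assoc = λ x y z → pointwise {x * y * z} {x * (y * z)} λ n → ℚₚ.*-assoc (seq x n) (seq y n) (seq z n)
        ; *-identity = (λ x → pointwise {1ℝ * x} {x} λ n → ℚₚ.*-identityˡ (seq x n))
                     , (λ x → pointwise {x * 1ℝ} {x} λ n → ℚₚ.*-identityʳ (seq x n))
        ; distrib = (λ x y z → pointwise {x * (y + z)} {x * y + x * z} λ n → ℚₚ.*-distribˡ-+ (seq x n) (seq y n) (seq z n))
                  , (λ x y z → pointwise {(y + z) * x} {y * x + z * x} λ n → ℚₚ.*-distribʳ-+ (seq x n) (seq y n) (seq z n)) }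
      ; zero = (λ x → pointwise {0ℝ * x} {0ℝ} λ n → ℚₚ.*-zeroˡ (seq x n))
             , (λ x → pointwise {x * 0ℝ} {0ℝ} λ n → ℚₚ.*-zeroʳ (seq x n)) }
    ; *-comm = *-comm } }

fromℚ-mono-≤ : ∀ {p q} → p ℚ.≤ q → fromℚ p ≤ fromℚ q
fromℚ-mono-≤ {p} {q} p≤q ε ε>0 = 0 , λ _ _ →
  ℚₚ.≤-<-trans p≤q (subst (ℚ._< q ℚ.+ ε) (ℚₚ.+-identityʳ q) (ℚₚ.+-monoʳ-< q ε>0))

fromℚ-cancel-≤ : ∀ {p q} → fromℚ p ≤ fromℚ q → ¬ q ℚ.< p
fromℚ-cancel-≤ {p} {q} p≤q q<p with p≤q (p ℚ.- q) (subst (ℚ._< p ℚ.- q) (ℚₚ.+-inverseʳ q) (ℚₚ.+-monoˡ-< (ℚ.- q) q<p))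
... | N , h = ℚₚ.<-irrefl (solve 2 (λ p q → p := q :+ (p :- q)) refl p q) (h N ℕₚ.≤-refl)

-- Constructive comparison: a Cauchy sequence is eventually close to one of its
-- terms, and that rational can be compared with the midpoint of q and r.
compare : ∀ x {q r} → q ℚ.< r → fromℚ q ≤ x ⊎ x ≤ fromℚ r
compare x {q} {r} q<r
  with ℚₚ.<-dense q<r
... | m , q<m , m<r with cauchy x ((m ℚ.- q) ℚ.⊓ (r ℚ.- m)) ε>0
  where
  positive-difference : ∀ {p q} → p ℚ.< q → 0ℚ ℚ.< q ℚ.- p
  positive-difference {p} {q} p<q = subst (ℚ._< q ℚ.- p) (ℚₚ.+-inverseʳ p) (ℚₚ.+-monoˡ-< (ℚ.- p) p<q)
  ε>0 : 0ℚ ℚ.< (m ℚ.- q) ℚ.⊓ (r ℚ.- m)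
  ε>0 = ⊓-glb-< (positive-difference q<m) (positive-difference m<r)
...   | N , close with m ℚ.≤? seq x N
...     | yes m≤x = inj₁ λ ε ε>0 → N , λ n N≤n →
  ℚₚ.<-trans {q} {seq x n}
    (subst₂ ℚ._<_ (solve 2 (λ m q → m :- (m :- q) := q) refl m q)
                  (solve 2 (λ a b → a :- (a :- b) := b) refl (seq x N) (seq x n))
      (ℚₚ.+-mono-≤-< m≤x (ℚₚ.neg-antimono-< (ℚₚ.<-≤-trans (∣∣<⇒< (close N n ℕₚ.≤-refl N≤n)) (ℚₚ.p⊓q≤p (m ℚ.- q) (r ℚ.- m))))))
    (subst (ℚ._< seq x n ℚ.+ ε) (ℚₚ.+-identityʳ (seq x n)) (ℚₚ.+-monoʳ-< (seq x n) ε>0))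
...     | no m≰x = inj₂ λ ε ε>0 → N , λ n N≤n →
  ℚₚ.<-trans {seq x n} {r}
    (subst₂ ℚ._<_ (solve 2 (λ a b → a :+ (b :- a) := b) refl (seq x N) (seq x n))
                  (solve 2 (λ m r → m :+ (r :- m) := r) refl m r)
      (ℚₚ.+-mono-< (ℚₚ.≰⇒> m≰x) (ℚₚ.<-≤-trans (∣∣<⇒< (close n N N≤n ℕₚ.≤-refl)) (ℚₚ.p⊓q≤q (m ℚ.- q) (r ℚ.- m)))))
    (subst (ℚ._< r ℚ.+ ε) (ℚₚ.+-identityʳ r) (ℚₚ.+-monoʳ-< r ε>0))

AtLeastPositive : ℝ → Set
AtLeastPositive w = ∃ λ q → 0ℚ ℚ.< q × fromℚ q ≤ w

1≉0 : ¬ 1ℝ ≈ 0ℝ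
1≉0 1≈0 = fromℚ-cancel-≤ {1ℚ} {0ℚ} (≤-reflexive {1ℝ} {0ℝ} 1≈0) (ℚₚ.positive⁻¹ 1ℚ)

ℝ-orderedSemiring : OrderedSemiring
ℝ-orderedSemiring = record
  { commutativeSemiring = ℝ-commutativeSemiring
  ; _≤_         = _≤_
  ; ≤-reflexive = λ {x} {y} → ≤-reflexive {x} {y}
  ; ≤-trans     = λ {x} {y} {z} → ≤-trans {x} {y} {z}
  ; ≤-antisym   = λ {x} {y} → ≤-antisym {x} {y}
  ; +-mono-≤    = λ {x} {y} {u} {v} → +-mono-≤ {x} {y} {u} {v}
  ; +-cancelˡ-≤ = λ {x} {y} → +-cancelˡ-≤ {x} {y}
  ; *-monoˡ-≤   = λ {x} {y} → *-monoˡ-≤ {x} {y}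
  ; Positive    = AtLeastPositive
  ; *-cancelˡ-≤ = λ {x} {y} w (q , q>0 , q≤w) → *-cancelˡ-≤ {x} {y} w q q>0 q≤w
  ; positive⇒0≤ = λ {w} (q , q>0 , q≤w) → ≤-trans {0ℝ} {fromℚ q} {w} (fromℚ-mono-≤ (ℚₚ.<⇒≤ q>0)) q≤w
  ; 0≤1         = fromℚ-mono-≤ (ℚₚ.<⇒≤ (ℚₚ.positive⁻¹ 1ℚ))
  ; 1≉0         = 1≉0
  }

module ℝSums = OrderedSums ℝ-orderedSemiring

fromℚ-≪ : ∀ {p q} → p ℚ.< q → ℝSums._≪_ (fromℚ p) (fromℚ q)
fromℚ-≪ {p} {q} p<q = fromℚ (q ℚ.- p)
  , (q ℚ.- p , subst (ℚ._< q ℚ.- p) (ℚₚ.+-inverseʳ p) (ℚₚ.+-monoˡ-< (ℚ.- p) p<q) , ≤-refl {fromℚ (q ℚ.- p)})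
  , pointwise {fromℚ p + fromℚ (q ℚ.- p)} {fromℚ q} λ _ → solve 2 (λ p q → p :+ (q :- p) := q) refl p q

some-or-all : ∀ {n} {A B : Fin n → Set} → (∀ i → A i ⊎ B i) → ∃ A ⊎ (∀ i → B i)
some-or-all {zero}  f = inj₂ λ ()
some-or-all {suc n} f with f zero | some-or-all (f ∘ suc)
... | inj₁ a | _            = inj₁ (zero , a)
... | inj₂ _ | inj₁ (i , a) = inj₁ (suc i , a)
... | inj₂ b | inj₂ bs      = inj₂ λ { zero → b ; (suc i) → bs i }

-- Four weights of at most ⅕ would sum to at most ⅘, less than 1. Any positive rational below ⅕
-- could replace ⅙: `compare` only needs a gap between its two thresholds.
positive-weight : ∀ (w : Vector ℝ 4) → ℝSums.Weights w → ∃ λ b → AtLeastPositive (w b)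
positive-weight w (_ , Σw≈1) = conclude (some-or-all λ b → compare (w b) (from-yes (⅙ ℚ.<? ⅕)))
  where
  ⅙ = + 1 ℚ./ 6
  ⅕ = + 1 ℚ./ 5
  conclude : (∃ λ b → fromℚ ⅙ ≤ w b) ⊎ (∀ b → w b ≤ fromℚ ⅕) → ∃ λ b → AtLeastPositive (w b)
  conclude (inj₁ (b , ⅙≤w)) = b , ⅙ , ℚₚ.positive⁻¹ ⅙ , ⅙≤w
  conclude (inj₂ w≤⅕) = ⊥-elim (fromℚ-cancel-≤ {1ℚ} {⅕ ℚ.+ (⅕ ℚ.+ (⅕ ℚ.+ (⅕ ℚ.+ 0ℚ)))}
    (≤-trans {1ℝ} {sum w} {sum {4} λ _ → fromℚ ⅕}
      (≤-reflexive {1ℝ} {sum w} (≈-sym {sum w} {1ℝ} Σw≈1))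
      (ℝSums.sum-mono-≤ {4} {w} {λ _ → fromℚ ⅕} w≤⅕))
    (from-yes (⅕ ℚ.+ (⅕ ℚ.+ (⅕ ℚ.+ (⅕ ℚ.+ 0ℚ))) ℚ.<? 1ℚ)))

-- The polytope Q

e-here : ∀ {n} i (j : Fin n) → e i j i j ≡ 1ℝ
e-here i j with i Fin.≟ i | j Fin.≟ j
... | yes _  | yes _  = refl
... | yes _  | no j≢j = ⊥-elim (j≢j refl)
... | no i≢i | _      = ⊥-elim (i≢i refl)

e-there : ∀ {n} i (j : Fin n) i′ j′ → ¬ (i′ ≡ i × j′ ≡ j) → e i j i′ j′ ≡ 0ℝ
e-there i j i′ j′ ≢ with i Fin.≟ i′ | j Fin.≟ j′
... | yes i≡ | yes j≡ = ⊥-elim (≢ (sym i≡ , sym j≡))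
... | yes _  | no _   = refl
... | no _   | _      = refl

reflexive : ∀ {x y} → x ≡ y → x ≈ y
reflexive {x} refl = ≈-refl {x}

distinct : ∀ {n} i (j : Fin n) i′ j′ → ¬ (i′ ≡ i × j′ ≡ j) → ¬ e i j ≋ e i′ j′
distinct i j i′ j′ ≢ e≋e′ = 1≉0 (≈-sym {0ℝ} {1ℝ}
  (subst₂ _≈_ (e-there i j i′ j′ ≢) (e-here i′ j′) (e≋e′ i′ j′)))

e-injective : ∀ {n} i (j : Fin n) i′ j′ → e i j ≋ e i′ j′ → i ≡ i′ × j ≡ j′
e-injective i j i′ j′ e≋e′ with i Fin.≟ i′ | j Fin.≟ j′
... | yes i≡ | yes j≡ = i≡ , j≡
... | yes _  | no j≢  = ⊥-elim (distinct i j i′ j′ (λ (_ , j≡) → j≢ (sym j≡)) e≋e′)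
... | no i≢  | _      = ⊥-elim (distinct i j i′ j′ (λ (i≡ , _) → i≢ (sym i≡)) e≋e′)

row : Fin 2 → Fin 4 → Fin 3
row i zero                   = inject₁ i
row i (suc zero)             = inject₁ i
row i (suc (suc zero))       = suc i
row i (suc (suc (suc zero))) = suc i

col : ∀ {m} → Fin m → Fin 4 → Fin (suc m)
col j zero                   = inject₁ j
col j (suc zero)             = suc j
col j (suc (suc zero))       = inject₁ j
col j (suc (suc (suc zero))) = suc j

inject₁≢suc : ∀ {n} (i : Fin n) → inject₁ i ≢ suc i
inject₁≢suc (suc i) eq = inject₁≢suc i (Finₚ.suc-injective eq)

row-col-injective : ∀ {m} i (j : Fin m) b b′ → row i b ≡ row i b′ → col j b ≡ col j b′ → b ≡ b′
row-col-injective i j zero                   zero                   _ _ = refl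
row-col-injective i j zero                   (suc zero)             _ c = ⊥-elim (inject₁≢suc j c)
row-col-injective i j zero                   (suc (suc zero))       r _ = ⊥-elim (inject₁≢suc i r)
row-col-injective i j zero                   (suc (suc (suc zero))) r _ = ⊥-elim (inject₁≢suc i r)
row-col-injective i j (suc zero)             zero                   _ c = ⊥-elim (inject₁≢suc j (sym c))
row-col-injective i j (suc zero)             (suc zero)             _ _ = refl
row-col-injective i j (suc zero)             (suc (suc zero))       r _ = ⊥-elim (inject₁≢suc i r)
row-col-injective i j (suc zero)             (suc (suc (suc zero))) r _ = ⊥-elim (inject₁≢suc i r)
row-col-injective i j (suc (suc zero))       zero                   r _ = ⊥-elim (inject₁≢suc i (sym r))
row-col-injective i j (suc (suc zero))       (suc zero)             r _ = ⊥-elim (inject₁≢suc i (sym r))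
row-col-injective i j (suc (suc zero))       (suc (suc zero))       _ _ = refl
row-col-injective i j (suc (suc zero))       (suc (suc (suc zero))) _ c = ⊥-elim (inject₁≢suc j c)
row-col-injective i j (suc (suc (suc zero))) zero                   r _ = ⊥-elim (inject₁≢suc i (sym r))
row-col-injective i j (suc (suc (suc zero))) (suc zero)             r _ = ⊥-elim (inject₁≢suc i (sym r))
row-col-injective i j (suc (suc (suc zero))) (suc (suc zero))       _ c = ⊥-elim (inject₁≢suc j (sym c))
row-col-injective i j (suc (suc (suc zero))) (suc (suc (suc zero))) _ _ = refl

adjacent-corner : ∀ {A : Set} {m} (h : Fin (suc m) → Fin 3 → A) i j b →
                  adjacent h j (corner₆ i b) ≡ h (col j b) (row i b)
adjacent-corner h zero       j zero                   = refl
adjacent-corner h zero       j (suc zero)             = refl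
adjacent-corner h zero       j (suc (suc zero))       = refl
adjacent-corner h zero       j (suc (suc (suc zero))) = refl
adjacent-corner h (suc zero) j zero                   = refl
adjacent-corner h (suc zero) j (suc zero)             = refl
adjacent-corner h (suc zero) j (suc (suc zero))       = refl
adjacent-corner h (suc zero) j (suc (suc (suc zero))) = refl

corners : ∀ {m} → Fin 2 → Fin m → Vector (Point (suc m)) 4
corners i j = e (inject₁ i) (inject₁ j) Vector.∷ e (inject₁ i) (suc j)
            Vector.∷ e (suc i) (inject₁ j) Vector.∷ e (suc i) (suc j) Vector.∷ Vector.[]

corners-e : ∀ {m} i (j : Fin m) b → corners i j b ≡ e (row i b) (col j b)
corners-e i j zero                   = refl
corners-e i j (suc zero)             = refl
corners-e i j (suc (suc zero))       = refl
corners-e i j (suc (suc (suc zero))) = refl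

corners-injective : ∀ {m} i (j : Fin m) b b′ → corners i j b ≋ corners i j b′ → b ≡ b′
corners-injective i j b b′ eq =
  let r , c = e-injective (row i b) (col j b) (row i b′) (col j b′)
        (subst₂ _≋_ (corners-e i j b) (corners-e i j b′) eq)
  in row-col-injective i j b b′ r c

-- Surjectivity of `G` supplies a definite preimage of each `F.to x`, which gives an injection from
-- `Fin k` to `Fin l`. Used both ways, it makes the vertex count unique.
Bijection⇒≤ : ∀ {k l} {S : Setoid 0ℓ 0ℓ} → Bijection (≡.setoid (Fin k)) S → Bijection (≡.setoid (Fin l)) S → k ≤ᴺ l
Bijection⇒≤ {k} {l} {S} F G = Finₚ.injective⇒≤ {f = f} λ {x} {y} fx≡fy → F.injective
  (S.trans (S.sym (to-f x)) (S.trans (S.reflexive (cong G.to fx≡fy)) (to-f y)))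
  where
  module F = Bijection F
  module G = Bijection G
  module S = Setoid S
  f : Fin k → Fin l
  f x = proj₁ (G.surjective (F.to x))
  to-f : ∀ x → G.to (f x) S.≈ F.to x
  to-f x = proj₂ (G.surjective (F.to x)) refl

module _ {k m n cols : ℕ} (p : Fin k → Fin m → Vector (Point cols) n) where
  open MinkowskiSum ℝ-orderedSemiring {3} {cols} {k} {m} {n} hiding (_≋_)

  nestedSum : Point cols → Set
  nestedSum = minkowskiSum λ i → minkowskiSum λ j → conv (p i j)

  combination-flatten : ∀ x (y : Vector (Point cols) k) (z : Fin k → Fin m → Point cols) (w : Weighting p) →
    x ≋ ∑ y → (∀ i → y i ≋ ∑ (z i)) → (∀ i j → z i j ≋ ∑ λ b → w i j b · p i j b) → x ≋ combination p w
  combination-flatten x y z w x≋ y≋ z≋ r s =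
    ℝSums.sum₂-flatten {k} {m} {x r s} {λ i → y i r s} {λ i j → z i j r s}
      {λ i j → ℝSums.sum λ b → w i j b ℝSums.* p i j b r s}
      (x≋ r s) (λ i → y≋ i r s) (λ i j → z≋ i j r s)

  gather : ∀ x (y : Vector (Point cols) k) (z : Fin k → Fin m → Point cols) →
           x ≋ ∑ y → (∀ i → y i ≋ ∑ (z i)) → (∀ i j → z i j ∈ conv (p i j)) → _∈Sum p x
  gather x y z x≋ y≋ z∈ = (λ i j → proj₁ (z∈ i j))
    , (λ i j → proj₁ (proj₂ (z∈ i j)) , proj₁ (proj₂ (proj₂ (z∈ i j))))
    , combination-flatten x y z (λ i j → proj₁ (z∈ i j)) x≋ y≋ (λ i j → proj₂ (proj₂ (proj₂ (z∈ i j))))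

  nestedSum⇒Sum : ∀ x → nestedSum x → _∈Sum p x
  nestedSum⇒Sum x (y , y∈ , x≋) = gather x y (λ i → proj₁ (y∈ i)) x≋
    (λ i → proj₂ (proj₂ (y∈ i))) (λ i → proj₁ (proj₂ (y∈ i)))

  Sum⇒nestedSum : ∀ x → _∈Sum p x → nestedSum x
  Sum⇒nestedSum x (w , W , x≋) = (λ i → ∑ (z i))
    , (λ i → z i , (λ j → w i j , proj₁ (W i j) , proj₂ (W i j) , λ r s → ≈-refl {z i j r s})
           , λ r s → ≈-refl {∑ (z i) r s})
    , x≋
    where
    z : Fin k → Fin m → Point cols
    z i j = ∑ λ b → w i j b · p i j b

  ⟨⟩≈dot : ∀ c x → ⟨ c , x ⟩ ≈ dot c x
  ⟨⟩≈dot c x = pointwise {⟨ c , x ⟩} {dot c x} λ _ → refl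

  dot≈⟨⟩ : ∀ c x → dot c x ≈ ⟨ c , x ⟩
  dot≈⟨⟩ c x = pointwise {dot c x} {⟨ c , x ⟩} λ _ → refl

  ≤dot⇒≤⟨⟩ : ∀ c x y → dot c x ≤ dot c y → ⟨ c , x ⟩ ≤ ⟨ c , y ⟩
  ≤dot⇒≤⟨⟩ c x y = ℝSums.≤-resp-≈ {dot c x} {⟨ c , x ⟩} {dot c y} {⟨ c , y ⟩} (dot≈⟨⟩ c x) (dot≈⟨⟩ c y)

  ≤⟨⟩⇒≤dot : ∀ c x y → ⟨ c , x ⟩ ≤ ⟨ c , y ⟩ → dot c x ≤ dot c y
  ≤⟨⟩⇒≤dot c x y = ℝSums.≤-resp-≈ {⟨ c , x ⟩} {dot c x} {⟨ c , y ⟩} {dot c y} (⟨⟩≈dot c x) (⟨⟩≈dot c y)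

  ≈⟨⟩⇒≈dot : ∀ c x y → ⟨ c , x ⟩ ≈ ⟨ c , y ⟩ → dot c x ≈ dot c y
  ≈⟨⟩⇒≈dot c x y eq = ≈-trans {dot c x} {⟨ c , x ⟩} {dot c y} (dot≈⟨⟩ c x)
    (≈-trans {⟨ c , x ⟩} {⟨ c , y ⟩} {dot c y} eq (⟨⟩≈dot c y))

  ≈dot⇒≈⟨⟩ : ∀ c x y → dot c x ≈ dot c y → ⟨ c , x ⟩ ≈ ⟨ c , y ⟩
  ≈dot⇒≈⟨⟩ c x y eq = ≈-trans {⟨ c , x ⟩} {dot c x} {⟨ c , y ⟩} (⟨⟩≈dot c x)
    (≈-trans {dot c x} {dot c y} {⟨ c , y ⟩} eq (dot≈⟨⟩ c y))

  Vertex : Set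
  Vertex = Setoid.Carrier (vertices nestedSum)

  maximizer⇒vertex : ∀ v c → UniqueMaximizer p c v → Σ Vertex λ x → proj₁ x ≡ v
  maximizer⇒vertex v c (maximizer v∈ maximal unique) = (v , Sum⇒nestedSum v v∈ , c , λ x x∈ →
    ≤dot⇒≤⟨⟩ c x v (maximal x (nestedSum⇒Sum x x∈)) ,
    λ eq → unique x (nestedSum⇒Sum x x∈) (≈⟨⟩⇒≈dot c x v eq)) , refl

  vertex⇒maximizer : ∀ (x : Vertex) → ∃ λ c → UniqueMaximizer p c (proj₁ x)
  vertex⇒maximizer (v , v∈ , c , c-top) = c , maximizer (nestedSum⇒Sum v v∈)
    (λ x x∈ → ≤⟨⟩⇒≤dot c x v (proj₁ (c-top x (Sum⇒nestedSum x x∈))))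
    (λ x x∈ eq → proj₂ (c-top x (Sum⇒nestedSum x x∈)) (≈dot⇒≈⟨⟩ c x v eq))

  top⇒vertex : ∀ c a → Top p c a → Σ Vertex λ x → proj₁ x ≡ chosen p a
  top⇒vertex c a a-top = maximizer⇒vertex (chosen p a) c (chosen-maximizer p c a a-top)

  vertex⇒weakTop : (∀ (w : Vector ℝ n) → ℝSums.Weights w → ∃ λ b → AtLeastPositive (w b)) →
                   (∀ i j b b′ → p i j b ≋ p i j b′ → b ≡ b′) →
                   ∀ (x : Vertex) → ∃ λ c → ∃ λ a → chosen p a ≋ proj₁ x × WeakTop p c a
  vertex⇒weakTop positive-weight p-injective x =
    proj₁ c-max , maximizer-chosen p (proj₁ c-max) positive-weight p-injective (proj₁ x) (proj₂ c-max)
    where c-max = vertex⇒maximizer x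

  same-choice : ∀ {c a a′} → Top p c a → (x y : Vertex) → proj₁ x ≡ chosen p a′ → proj₁ y ≡ chosen p a →
                proj₁ x ≋ proj₁ y → ∀ i j → a′ i j ≡ a i j
  same-choice {c} {a} {a′} a-top x y x≡ y≡ x≋y =
    chosen-injective p c a a-top a′ (subst₂ (MinkowskiSum._≋_ ℝ-orderedSemiring {3} {cols} {k} {m} {n}) x≡ y≡ x≋y)

  same-point : ∀ {a a′} (x y : Vertex) → proj₁ x ≡ chosen p a′ → chosen p a ≋ proj₁ y →
               (∀ i j → a′ i j ≡ a i j) → proj₁ x ≋ proj₁ y
  same-point {a} {a′} x y x≡ a≋y a′≡a = subst (_≋ proj₁ y) (sym x≡) λ r s →
    ≈-trans {chosen p a′ r s} {chosen p a r s} {proj₁ y r s} (chosen-cong p {a′} {a} a′≡a r s) (a≋y r s)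

-- Runs and vertices of the polytope

module _ (m : ℕ) where
  open MinkowskiSum ℝ-orderedSemiring {3} {suc m} {2} {m} {4} hiding (_≋_)

  value-corner : ∀ c i j b → value corners c i j b ≈ c (row i b) (col j b)
  value-corner c i j b = subst (λ x → dot c x ≈ c (row i b) (col j b)) (sym (corners-e i j b))
    (dot-unit c (e (row i b) (col j b)) (row i b) (col j b)
      (reflexive (e-here (row i b) (col j b)))
      λ r s rs≢ → reflexive (e-there (row i b) (col j b) r s rs≢))

  realizes-top : ∀ h c a → (∀ i j → c i j ≡ fromℚ (h j i)) → Realizes ℚ._<_ h (flip a) → Top corners c a
  realizes-top h c a c≡h realizes = top λ i j b b≢a → ℝSums.≪-resp-≈
    {c (row i b) (col j b)} {value corners c i j b}
    {c (row i (a i j)) (col j (a i j))} {value corners c i j (a i j)}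
    (≈-sym {value corners c i j b} {c (row i b) (col j b)} (value-corner c i j b))
    (≈-sym {value corners c i j (a i j)} {c (row i (a i j)) (col j (a i j))} (value-corner c i j (a i j)))
    (subst₂ ℝSums._≪_ (sym (c≡h (row i b) (col j b))) (sym (c≡h (row i (a i j)) (col j (a i j))))
      (fromℚ-≪ (subst₂ ℚ._<_ (adjacent-corner h i j b) (adjacent-corner h i j (a i j)) (realizes j i b b≢a))))

  choice : Run zero m → Fin 2 → Fin m → Fin 4
  choice r = flip (choices zero m r)

  functional : Run zero m → Point (suc m)
  functional r i j = fromℚ (proj₁ (run-heights zero m r) j i)

  choice-top : ∀ r → Top corners (functional r) (choice r)
  choice-top r = realizes-top (proj₁ (run-heights zero m r)) (functional r) (choice r) (λ i j → refl)
    (proj₂ (proj₂ (run-heights zero m r)))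

  -- The negative form of strictness that a vertex yields. It is transitive and irreflexive, which
  -- is all that `realized-run` asks.
  _≺_ : ℝ → ℝ → Set
  x ≺ y = x ≤ y × ¬ y ≤ x

  ≺-trans : ∀ {x y z} → x ≺ y → y ≺ z → x ≺ z
  ≺-trans {x} {y} {z} (x≤y , y≰x) (y≤z , _) =
    ≤-trans {x} {y} {z} x≤y y≤z , λ z≤x → y≰x (≤-trans {y} {z} {x} y≤z z≤x)

  ≺-irrefl : ∀ {x} → ¬ x ≺ x
  ≺-irrefl (x≤x , x≰x) = x≰x x≤x

  weakTop-realizes : ∀ {c a} → WeakTop corners c a → Realizes _≺_ (flip c) (flip a)
  weakTop-realizes {c} {a} (weakTop dominates) j i b b≢a =
    to b (a i j) (proj₁ (dominates i j b b≢a)) ,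
    λ a≤b → proj₂ (dominates i j b b≢a) (from (a i j) b a≤b)
    where
    height : Fin 4 → ℝ
    height b = adjacent (flip c) j (corner₆ i b)
    value≈height : ∀ b → value corners c i j b ≈ height b
    value≈height b = subst (value corners c i j b ≈_) (sym (adjacent-corner (flip c) i j b)) (value-corner c i j b)
    to : ∀ b b′ → value corners c i j b ≤ value corners c i j b′ → height b ≤ height b′
    to b b′ = ℝSums.≤-resp-≈ {value corners c i j b} {height b} {value corners c i j b′} {height b′}
      (value≈height b) (value≈height b′)
    from : ∀ b b′ → height b ≤ height b′ → value corners c i j b ≤ value corners c i j b′
    from b b′ = ℝSums.≤-resp-≈ {height b} {value corners c i j b} {height b′} {value corners c i j b′}
      (≈-sym {value corners c i j b} {height b} (value≈height b))
      (≈-sym {value corners c i j b′} {height b′} (value≈height b′))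

  vertexAt : (r : Run zero m) → Σ (Vertex corners) λ x → proj₁ x ≡ chosen corners (choice r)
  vertexAt r = top⇒vertex corners (functional r) (choice r) (choice-top r)

  vertexAt-injective : ∀ r r′ → proj₁ (proj₁ (vertexAt r)) ≋ proj₁ (proj₁ (vertexAt r′)) → r ≡ r′
  vertexAt-injective r r′ eq = choices-injective zero m r r′ λ j i →
    same-choice corners {functional r′} {choice r′} {choice r} (choice-top r′)
      (proj₁ (vertexAt r)) (proj₁ (vertexAt r′)) (proj₂ (vertexAt r)) (proj₂ (vertexAt r′)) eq i j

  vertexAt-surjective : ∀ y → ∃ λ r → proj₁ (proj₁ (vertexAt r)) ≋ proj₁ y
  vertexAt-surjective y = r ,
    same-point corners {a} {choice r} (proj₁ (vertexAt r)) y (proj₂ (vertexAt r)) a≋y (λ i j → proj₂ run j i)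
    where
    found = vertex⇒weakTop corners positive-weight corners-injective y
    c = proj₁ found
    a = proj₁ (proj₂ found)
    a≋y = proj₁ (proj₂ (proj₂ found))
    run : Σ (Run zero m) λ r → ∀ j i → choices zero m r j i ≡ flip a j i
    run = realized-run _≺_ (λ {x} {y} {z} → ≺-trans {x} {y} {z}) (λ {x} → ≺-irrefl {x})
      -- The empty list suffices because the initial state imposes no order on the first column.
      zero m (flip c) (flip a) [] (weakTop-realizes (proj₂ (proj₂ (proj₂ found))))
    r = proj₁ run

  corners-count : HasVertexCount (nestedSum corners) (count m zero)
  corners-count = record
    { to        = λ k → proj₁ (vertexAt (from k))
    ; cong      = λ { {k} refl i j → ≈-refl {proj₁ (proj₁ (vertexAt (from k))) i j} }
    ; bijective = (λ {k} {l} eq → from-injective k l (vertexAt-injective (from k) (from l) eq))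
                , λ y → to (proj₁ (vertexAt-surjective y)) , λ { refl →
                    subst (λ r → proj₁ (proj₁ (vertexAt r)) ≋ proj₁ y)
                      (sym (strictlyInverseʳ (proj₁ (vertexAt-surjective y)))) (proj₂ (vertexAt-surjective y)) }
    }
    where
    open Inverse (run↔Fin zero m)
    from-injective : ∀ k l → from k ≡ from l → k ≡ l
    from-injective k l eq = trans (sym (strictlyInverseˡ k)) (trans (cong to eq) (strictlyInverseˡ l))

  -- At `suc m` columns `here` and `next` compute to `inject₁` and `suc`, so `Q` unfolds to the
  -- nested sum over `corners`.
  vertex-count : HasVertexCount (Q (suc m)) (count m zero)
  vertex-count = corners-count

theorem1p4 : (∀ n → 2 ≤ᴺ n → ∃ λ k → HasVertexCount (Q n) k) ×
    (∀ (V : ℕ → ℕ) → (∀ n → 2 ≤ᴺ n → HasVertexCount (Q n) (V n)) →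
    (V 2 ≡ 14 × V 3 ≡ 150 × V 4 ≡ 1536) ×
    (x+∑ V) ≐ polynomial (+ 0 ∷ + 1 ∷ + 1 ∷ (- (+ 1)) ∷ []) / polynomial (+ 1 ∷ (- (+ 13)) ∷ + 31 ∷ (- (+ 20)) ∷ + 4 ∷ []))
theorem1p4 = (λ { (suc m) _ → count m zero , vertex-count m }) , λ V V-counts →
  let V≡ : ∀ n → V (suc (suc n)) ≡ vertexCount (suc (suc n))
      V≡ n = HasVertexCount-unique {suc (suc n)} (V-counts (suc (suc n)) (ℕ.s≤s (ℕ.s≤s ℕ.z≤n))) (vertex-count (suc n))
  in (trans (V≡ 0) vertexCount₂ , trans (V≡ 1) vertexCount₃ , trans (V≡ 2) vertexCount₄)
   -- The coefficients at 0 and 1 are the same for every `V`; from 2 on, uniqueness of the count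
   -- replaces `V` by `vertexCount`.
   , q⁻¹ , q⊛q⁻¹ , λ { 0 → vertexCount-expansion 0
                     ; 1 → vertexCount-expansion 1
                     ; (suc (suc n)) → trans (cong +_ (V≡ n)) (vertexCount-expansion (suc (suc n))) }
  where
  HasVertexCount-unique : ∀ {n k l} → HasVertexCount (Q n) k → HasVertexCount (Q n) l → k ≡ l
  HasVertexCount-unique {n} F G = ℕₚ.≤-antisym (Bijection⇒≤ {S = vertices (Q n)} F G) (Bijection⇒≤ {S = vertices (Q n)} G F)
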